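{- Let $\varepsilon\in(0,1]$ and $n,r,q,t\ge1$ satisfy $\varepsilon r\ge 24q$. Let $\mathcal{A}\subset 2^{[n]}$ be a weakly $(r,t)$-spread family and let $\mathcal{S}\subset\binom{[n]}{\le q}$ be a non-trivial $t$-intersecting family. Then there exists a $t$-element set $T\subset[n]$ such that $|\mathcal{A}[\mathcal{S}]|\le\varepsilon|\mathcal{A}[T]|$.
   Context: For $X\subset[n]$ and $\mathcal{A}\subset2^{[n]}$: $\mathcal{A}(X)=\{A\setminus X: A\in\mathcal{A},\ X\subset A\}$, $\mathcal{A}[X]=\{A\in\mathcal{A}: X\subset A\}$, and $\mathcal{A}[\mathcal{S}]=\bigcup_{S\in\mathcal{S}}\mathcal{A}[S]$. $\mathcal{A}$ is weakly $(r,t)$-spread if there exists a set $T\subset[n]$ of size $t$ such that for every nonnegative integer $s$ and every $U\subset[n]$ with $|U|=t+s$ we have $|\mathcal{A}(U)|\le r^{ -s}|\mathcal{A}(T)|$. A family $\mathcal{S}$ is $t$-intersecting if any two members share at least $t$ elements, and a $t$-intersecting family is non-trivial if $|\bigcap_{F\in\mathcal{S}}F|<t$.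
   Formalization: The parameters ε ∈ (0,1] and r ≥ 1, which the statement takes to be real, are restricted to rational numbers. -}

module Defs where

open import Data.Nat as ℕ using (ℕ; zero; suc)
open import Data.Bool using (Bool; true; false; _∧_; _∨_; not; if_then_else_)
import Data.Bool as Bool
open import Data.Fin using (Fin)
open import Data.Vec using (Vec; []; _∷_; map)
open import Data.Vec.Properties using (≡-dec)
open import Data.Fin.Subset using (Subset; inside; outside; ⊤; _∩_; _─_; ∣_∣)
open import Data.Fin.Subset.Properties using (_⊆?_)
open import Data.List using (List; []; _∷_; _++_; filter; length; foldr)
open import Data.Bool.ListAction using (any)
import Data.List as List
open import Data.Rational using (ℚ; _*_; 1ℚ; _≤_)
open import Data.Product using (Σ; _×_)
open import Relation.Nullary.Decidable using (⌊_⌋; Dec)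
open import Data.Integer using (+_)
open import Relation.Binary.PropositionalEquality using (_≡_)

_≟ₛ_ : ∀ {n} (X Y : Subset n) → Dec (X ≡ Y)
_≟ₛ_ = ≡-dec Bool._≟_

Family : ℕ → Set
Family n = Subset n → Bool

allSubsets : (n : ℕ) → List (Subset n)
allSubsets zero    = [] ∷ []
allSubsets (suc n) = List.map (outside ∷_) (allSubsets n) ++ List.map (inside ∷_) (allSubsets n)

members : ∀ {n} → Family n → List (Subset n)
members {n} 𝒜 = filter (λ A → 𝒜 A Bool.≟ true) (allSubsets n)

#_ : ∀ {n} → Family n → ℕ
# 𝒜 = length (members 𝒜)

_⊆ᵇ_ : ∀ {n} → Subset n → Subset n → Bool
X ⊆ᵇ Y = ⌊ X ⊆? Y ⌋

_⟨_⟩ : ∀ {n} → Family n → Subset n → Family n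
(𝒜 ⟨ X ⟩) B = any (λ A → (X ⊆ᵇ A) ∧ ⌊ (A ─ X) ≟ₛ B ⌋) (members 𝒜)

_[_] : ∀ {n} → Family n → Subset n → Family n
(𝒜 [ X ]) A = 𝒜 A ∧ (X ⊆ᵇ A)

_[[_]] : ∀ {n} → Family n → Family n → Family n
(𝒜 [[ 𝒮 ]]) A = any (λ S → (𝒜 [ S ]) A) (members 𝒮)

_^ℚ_ : ℚ → ℕ → ℚ
r ^ℚ zero  = 1ℚ
r ^ℚ suc s = r * (r ^ℚ s)

ℕ→ℚ : ℕ → ℚ
ℕ→ℚ k = (+ k) Data.Rational./ 1

-- 𝒜 is weakly (r,t)-spread: there is T ⊆ [n], |T| = t, such that for all s ≥ 0 and
-- all U ⊆ [n] with |U| = t + s, |𝒜(U)| ≤ r^{-s} |𝒜(T)|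
-- (written as r^s · |𝒜(U)| ≤ |𝒜(T)|, which is the same since r > 0 where used).
WeaklySpread : ∀ {n} → ℚ → ℕ → Family n → Set
WeaklySpread {n} r t 𝒜 =
  Σ (Subset n) λ T → (∣ T ∣ ≡ t) ×
    ((s : ℕ) (U : Subset n) → ∣ U ∣ ≡ t ℕ.+ s →
       (r ^ℚ s) * ℕ→ℚ (# (𝒜 ⟨ U ⟩)) ≤ ℕ→ℚ (# (𝒜 ⟨ T ⟩)))

TIntersecting : ∀ {n} → ℕ → Family n → Set
TIntersecting {n} t 𝒮 =
  (F G : Subset n) → 𝒮 F ≡ true → 𝒮 G ≡ true → t ℕ.≤ ∣ F ∩ G ∣

-- ⋂_{F ∈ 𝒮} F  (equal to [n] when 𝒮 is empty)
⋂ : ∀ {n} → Family n → Subset n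
⋂ 𝒮 = foldr _∩_ ⊤ (members 𝒮)

NonTrivial : ∀ {n} → ℕ → Family n → Set
NonTrivial t 𝒮 = ∣ ⋂ 𝒮 ∣ ℕ.< t

AtMostSize : ∀ {n} → ℕ → Family n → Set
AtMostSize {n} q 𝒮 = (F : Subset n) → 𝒮 F ≡ true → ∣ F ∣ ℕ.≤ q

{-# OPTIONS --safe #-}
-- Call F in a t-intersecting family 𝒮 tight if removing any element of F destroys the
-- property that F meets every member of 𝒮 in at least t elements. Sets of the top size t+s
-- that are not tight may be shrunk by one element: this only enlarges 𝒜[𝒮]. Once all the sets
-- of size t+s are tight they are removed, and one continues with size t+s-1, until all remaining
-- sets contain a common t-set T; some removed G does not contain T, so the rest is covered by the
-- at most q families 𝒜[T ∪ {y}] with y ∈ G.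
--
-- For the tight sets W of size t+s: a set X smaller than F ∈ W that is contained in F meets
-- some G ∈ 𝒮 in fewer than t elements, so extensions of X to members of W branch into at most
-- q directions. Starting from all t-sets X would be too costly. Instead, tightness gives F, G
-- with F ∈ W and |F ∩ G| = t, and one starts from the traces X = H ∩ (F ∪ G) of H ∈ W. Since
-- |X| + |X ∩ F ∩ G| = |H ∩ F| + |H ∩ G| ≥ 2t, a trace missing j elements of F ∩ G has at least
-- t+j elements, which saves a factor qʲ; as (1 + 1/q)ᵗ ≤ 3 and |F △ G| ≤ 2s, the traces
-- contribute a factor 3·4ˢ in total, whence |𝒜[W]| ≤ 3 (4q)ˢ max |𝒜(U)| over |U| = t+s.
-- Since 4q ≤ εr/6, summing over s ≥ 1 gives at most 3ε/5 times the largest |𝒜[U]| with |U| = t,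
-- and the last step contributes at most ε/24 times it.
module Submission where

open import Defs
open import Level using (0ℓ)
open import Data.Bool using (true; T)
import Data.Bool as Bool
open import Data.Bool.Properties using (T-≡; T-∧)
open import Data.Empty using (⊥-elim)
open import Data.Fin using (Fin; zero; suc)
import Data.Fin.Properties as Finₚ
open import Data.Fin.Subset using (Subset; inside; outside; ∣_∣; _∈_; _∉_; _⊆_; _∩_; _∪_; _─_; _-_; ∁; ⁅_⁆; ⊤)
open import Data.Fin.Subset.Properties
open import Data.List using (List; []; _∷_; _++_; filter; foldr; length; map; upTo)
open import Data.List.Properties using (length-map; length-++; filter-notAll)
open import Data.List.Membership.Propositional using (find; lose) renaming (_∈_ to _∈ₗ_)
open import Data.List.Membership.Propositional.Properties
open import Data.List.Relation.Binary.Subset.Propositional using () renaming (_⊆_ to _⊆ₗ_)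
open import Data.List.Relation.Unary.All as All using (All; []; _∷_)
open import Data.List.Relation.Unary.All.Properties using (¬All⇒Any¬)
open import Data.List.Relation.Unary.AllPairs using ([]; _∷_)
open import Data.List.Relation.Unary.Any as Any using (Any; here; there)
import Data.List.Relation.Unary.Any.Properties as Anyₚ
open import Data.List.Relation.Unary.Unique.Propositional using (Unique)
import Data.List.Relation.Unary.Unique.Propositional.Properties as Unique
open import Data.Nat using (ℕ; _≥_; zero; suc; _+_; _∸_; _^_; z≤n; s≤s) renaming (_*_ to _·_; _≤_ to _≤ₙ_; _<_ to _<ₙ_)
open import Data.Nat.ListAction using (sum)
import Data.Nat as ℕ
import Data.Nat.Properties as ℕₚ
open import Data.Nat.Tactic.RingSolver using (solve-∀)
open import Data.Product using (Σ; ∃; _×_; _,_; proj₁; proj₂)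
open import Data.Sum using (_⊎_; inj₁; inj₂; [_,_]′)
open import Data.Vec using ([]; _∷_; here; there)
open import Data.Vec.Properties using (∷-injectiveʳ)
open import Function using (_∘_; case_of_; Equivalence)
open import Relation.Nullary using (¬_; Dec; yes; no; contradiction)
open import Relation.Nullary.Decidable using (_×-dec_; ¬?; decidable-stable; toWitness; fromWitness)
open import Relation.Unary using (Pred; Decidable)
open import Relation.Binary.PropositionalEquality hiding ([_])
import Data.Integer as ℤ
import Data.Integer.Properties as ℤₚ
open import Data.Rational using (ℚ; toℚᵘ; _≤_; _<_; 0ℚ; 1ℚ; _*_; NonNegative; nonNegative)
open import Data.Rational.Properties using (toℚᵘ-injective; toℚᵘ-cancel-≤; toℚᵘ-homo-*; toℚᵘ-fromℚᵘ; nonNegative⁻¹; nonNeg*nonNeg⇒nonNeg)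
import Data.Rational.Properties as ℚₚ
open import Data.Rational.Unnormalised using (mkℚᵘ; *≡*; *≤*)
import Data.Rational.Unnormalised as ℚᵘ
import Data.Rational.Unnormalised.Properties as ℚᵘₚ

private variable
  n k : ℕ

-- Counting subsets that satisfy a predicate

∈-allSubsets : (X : Subset n) → X ∈ₗ allSubsets n
∈-allSubsets []            = here refl
∈-allSubsets (outside ∷ X) = ∈-++⁺ˡ (∈-map⁺ _ (∈-allSubsets X))
∈-allSubsets (inside ∷ X)  = ∈-++⁺ʳ _ (∈-map⁺ _ (∈-allSubsets X))

allSubsets-unique : ∀ n → Unique (allSubsets n)
allSubsets-unique zero    = [] ∷ []
allSubsets-unique (suc n) = Unique.++⁺ (Unique.map⁺ ∷-injectiveʳ u) (Unique.map⁺ ∷-injectiveʳ u) disjoint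
  where
  u = allSubsets-unique n
  disjoint : ∀ {X} → ¬ (X ∈ₗ map (outside ∷_) (allSubsets n) × X ∈ₗ map (inside ∷_) (allSubsets n))
  disjoint (p , q) with ∈-map⁻ _ p | ∈-map⁻ _ q
  ... | _ , _ , refl | _ , _ , ()

-- Deleting one occurrence of `x` from `ys` keeps the other members of `xs` inside, because none of
-- them equals `x`.
Unique-⊆⇒length≤ : {B : Set} {xs ys : List B} → Unique xs → xs ⊆ₗ ys → length xs ≤ₙ length ys
Unique-⊆⇒length≤ {xs = []} _ _ = z≤n
Unique-⊆⇒length≤ {xs = x ∷ xs} (x∉ ∷ u) xs⊆ys with ∈-∃++ (xs⊆ys (here refl))
... | ys₁ , ys₂ , refl = begin
  suc (length xs)                    ≤⟨ s≤s (Unique-⊆⇒length≤ u without) ⟩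
  suc (length (ys₁ ++ ys₂))          ≡⟨ cong suc (length-++ ys₁) ⟩
  suc (length ys₁ + length ys₂)      ≡⟨ ℕₚ.+-suc _ _ ⟨
  length ys₁ + suc (length ys₂)      ≡⟨ length-++ ys₁ ⟨
  length (ys₁ ++ x ∷ ys₂)            ∎
  where
  open ℕₚ.≤-Reasoning
  without : xs ⊆ₗ ys₁ ++ ys₂
  without z∈ with ∈-++⁻ ys₁ (xs⊆ys (there z∈))
  ... | inj₁ p           = ∈-++⁺ˡ p
  ... | inj₂ (here refl) = contradiction refl (All.lookup x∉ z∈)
  ... | inj₂ (there p)   = ∈-++⁺ʳ ys₁ p

count : {P : Pred (Subset n) 0ℓ} → Decidable P → ℕ
count P? = length (filter P? (allSubsets _))

module _ {P Q : Pred (Subset n) 0ℓ} (P? : Decidable P) (Q? : Decidable Q) where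

  -- Injectivity is demanded only on `P`, so that removing `U` from supersets of `U` qualifies.
  count-injection : (f : Subset n → Subset n) → (∀ {A} → P A → Q (f A)) →
    (∀ {A B} → P A → P B → f A ≡ f B → A ≡ B) → count P? ≤ₙ count Q?
  count-injection f P⇒Q inj = subst (_≤ₙ count Q?) (length-map f (filter P? (allSubsets n)))
    (Unique-⊆⇒length≤
      (map-unique (Unique.filter⁺ P? (allSubsets-unique n)) (proj₂ ∘ ∈-filter⁻ P? {xs = allSubsets n})) image)
    where
    map-unique : ∀ {xs} → Unique xs → (∀ {A} → A ∈ₗ xs → P A) → Unique (map f xs)
    map-unique [] _ = []
    map-unique {A ∷ xs} (A∉ ∷ u) allP = All.tabulate fresh ∷ map-unique u (allP ∘ there)
      where
      fresh : ∀ {Y} → Y ∈ₗ map f xs → f A ≢ Y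
      fresh Y∈ eq with ∈-map⁻ f Y∈
      ... | B , B∈ , refl = All.lookup A∉ B∈ (inj (allP (here refl)) (allP (there B∈)) eq)
    image : map f (filter P? (allSubsets n)) ⊆ₗ filter Q? (allSubsets n)
    image Y∈ with ∈-map⁻ f Y∈
    ... | A , A∈ , refl = ∈-filter⁺ Q? (∈-allSubsets _) (P⇒Q (proj₂ (∈-filter⁻ P? {xs = allSubsets n} A∈)))

  count-mono : (∀ {A} → P A → Q A) → count P? ≤ₙ count Q?
  count-mono P⇒Q = count-injection (λ A → A) P⇒Q (λ _ _ eq → eq)

module _ {P Q R : Pred (Subset n) 0ℓ} (P? : Decidable P) (Q? : Decidable Q) (R? : Decidable R) where

  count-∪ : (∀ {A} → P A → Q A ⊎ R A) → count P? ≤ₙ count Q? + count R?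
  count-∪ P⇒Q⊎R = subst (count P? ≤ₙ_) (length-++ (filter Q? (allSubsets n)))
    (Unique-⊆⇒length≤ (Unique.filter⁺ P? (allSubsets-unique n)) split)
    where
    split : filter P? (allSubsets n) ⊆ₗ filter Q? (allSubsets n) ++ filter R? (allSubsets n)
    split {A} A∈ with P⇒Q⊎R (proj₂ (∈-filter⁻ P? {xs = allSubsets n} A∈))
    ... | inj₁ QA = ∈-++⁺ˡ (∈-filter⁺ Q? (∈-allSubsets _) QA)
    ... | inj₂ RA = ∈-++⁺ʳ _ (∈-filter⁺ R? (∈-allSubsets _) RA)

count-∅ : {P : Pred (Subset n) 0ℓ} (P? : Decidable P) → (∀ {A} → ¬ P A) → count P? ≡ 0
count-∅ {n} P? ¬P with filter P? (allSubsets n) in eq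
... | []     = refl
... | A ∷ _ = ⊥-elim (¬P (proj₂ (∈-filter⁻ P? {xs = allSubsets n} (subst (A ∈ₗ_) (sym eq) (here refl)))))

-- Union bound by induction: what the head `x` covers is taken out of `P` before passing to the
-- tail.
count-⋃-list : {B : Set} (xs : List B) {P : Pred (Subset n) 0ℓ} (P? : Decidable P)
  {Q : B → Pred (Subset n) 0ℓ} (Q? : ∀ b → Decidable (Q b)) →
  (∀ {A} → P A → ∃ λ b → b ∈ₗ xs × Q b A) → count P? ≤ₙ sum (map (count ∘ Q?) xs)
count-⋃-list [] P? Q? cover = ℕₚ.≤-reflexive (count-∅ P? (λ PA → case cover PA of λ { (_ , () , _) }))
count-⋃-list (x ∷ xs) {P} P? {Q} Q? cover =
  ℕₚ.≤-trans (count-∪ P? (Q? x) P∖Q? split) (ℕₚ.+-monoʳ-≤ _ (count-⋃-list xs P∖Q? Q? cover′))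
  where
  P∖Q? : Decidable (λ A → P A × ¬ Q x A)
  P∖Q? A = P? A ×-dec ¬? (Q? x A)
  split : ∀ {A} → P A → Q x A ⊎ (P A × ¬ Q x A)
  split {A} PA with Q? x A
  ... | yes QA = inj₁ QA
  ... | no ¬QA = inj₂ (PA , ¬QA)
  cover′ : ∀ {A} → P A × ¬ Q x A → ∃ λ b → b ∈ₗ xs × Q b A
  cover′ (PA , ¬QA) with cover PA
  ... | b , here refl , QA = contradiction QA ¬QA
  ... | b , there b∈ , QA  = b , b∈ , QA

-- Elements of a subset, list sums and cardinalities

elements : Subset k → List (Fin k)
elements []            = []
elements (outside ∷ Y) = map suc (elements Y)
elements (inside ∷ Y)  = zero ∷ map suc (elements Y)

length-elements : (Y : Subset k) → length (elements Y) ≡ ∣ Y ∣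
length-elements []            = refl
length-elements (outside ∷ Y) = trans (length-map Fin.suc (elements Y)) (length-elements Y)
length-elements (inside ∷ Y)  = cong suc (trans (length-map Fin.suc (elements Y)) (length-elements Y))

∈-elements⁺ : {Y : Subset k} {y : Fin k} → y ∈ Y → y ∈ₗ elements Y
∈-elements⁺ {Y = inside ∷ Y}  {zero}  _  = here refl
∈-elements⁺ {Y = outside ∷ Y} {zero}  ()
∈-elements⁺ {Y = inside ∷ Y}  {suc y} p = there (∈-map⁺ suc (∈-elements⁺ (drop-there p)))
∈-elements⁺ {Y = outside ∷ Y} {suc y} p = ∈-map⁺ suc (∈-elements⁺ (drop-there p))

∈-elements⁻ : {Y : Subset k} {y : Fin k} → y ∈ₗ elements Y → y ∈ Y
∈-elements⁻ {Y = inside ∷ Y}  (here refl) = here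
∈-elements⁻ {Y = inside ∷ Y}  (there y∈) with ∈-map⁻ suc y∈
... | _ , z∈ , refl = there (∈-elements⁻ z∈)
∈-elements⁻ {Y = outside ∷ Y} y∈ with ∈-map⁻ suc y∈
... | _ , z∈ , refl = there (∈-elements⁻ z∈)

sum-map-≤ : {B : Set} (f : B → ℕ) {m : ℕ} (xs : List B) → (∀ {b} → b ∈ₗ xs → f b ≤ₙ m) →
  sum (map f xs) ≤ₙ length xs · m
sum-map-≤ f []       h = z≤n
sum-map-≤ f (x ∷ xs) h = ℕₚ.+-mono-≤ (h (here refl)) (sum-map-≤ f xs (h ∘ there))

sum-map-*-≤ : {B : Set} (f g : B → ℕ) (c d : ℕ) → (∀ b → f b · c ≤ₙ d · g b) → (xs : List B) →
  sum (map f xs) · c ≤ₙ d · sum (map g xs)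
sum-map-*-≤ f g c d h []       = z≤n
sum-map-*-≤ f g c d h (x ∷ xs) = begin
  (f x + sum (map f xs)) · c          ≡⟨ ℕₚ.*-distribʳ-+ c (f x) _ ⟩
  f x · c + sum (map f xs) · c        ≤⟨ ℕₚ.+-mono-≤ (h x) (sum-map-*-≤ f g c d h xs) ⟩
  d · g x + d · sum (map g xs)        ≡⟨ ℕₚ.*-distribˡ-+ d (g x) _ ⟨
  d · (g x + sum (map g xs))          ∎
  where open ℕₚ.≤-Reasoning

-- Otherwise `F ∩ G` would lie in `X ∩ G`. This drives all branching: such an `F` leaves `X` through
-- an element of `G`.
escape : (X F G : Subset n) → ∣ X ∩ G ∣ <ₙ ∣ F ∩ G ∣ → ∃ λ y → y ∈ F × y ∈ G × y ∉ X
escape X F G X<F with Finₚ.any? (λ y → (y ∈? F) ×-dec (y ∈? G) ×-dec ¬? (y ∈? X))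
... | yes p = p
... | no ¬p = contradiction (p⊆q⇒∣p∣≤∣q∣ sub) (ℕₚ.<⇒≱ X<F)
  where
  sub : F ∩ G ⊆ X ∩ G
  sub {y} y∈ with x∈p∩q⁻ F G y∈
  ... | y∈F , y∈G = x∈p∩q⁺ (decidable-stable (y ∈? X) (λ y∉X → ¬p (y , y∈F , y∈G , y∉X)) , y∈G)

∣X∪⁅y⁆∣ : (X : Subset n) {y : Fin n} → y ∉ X → ∣ X ∪ ⁅ y ⁆ ∣ ≡ suc ∣ X ∣
∣X∪⁅y⁆∣ (inside ∷ X)  {zero}  y∉ = contradiction here y∉
∣X∪⁅y⁆∣ (outside ∷ X) {zero}  y∉ = cong (suc ∘ ∣_∣) (∪-identityʳ X)
∣X∪⁅y⁆∣ (inside ∷ X)  {suc y} y∉ = cong suc (∣X∪⁅y⁆∣ X (drop-not-there y∉))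
∣X∪⁅y⁆∣ (outside ∷ X) {suc y} y∉ = ∣X∪⁅y⁆∣ X (drop-not-there y∉)

⊆∧≥⇒≡ : {X Y : Subset n} → X ⊆ Y → ∣ Y ∣ ≤ₙ ∣ X ∣ → X ≡ Y
⊆∧≥⇒≡ {X = X} {Y} X⊆Y Y≤X = ⊆-antisym X⊆Y Y⊆X
  where
  Y⊆X : Y ⊆ X
  Y⊆X {y} y∈Y = decidable-stable (y ∈? X)
    (λ y∉X → ℕₚ.<⇒≱ (p⊂q⇒∣p∣<∣q∣ (X⊆Y , y , y∈Y , y∉X)) Y≤X)

x∈p─q⇒x∉q : {p q : Subset n} {x : Fin n} → x ∈ p ─ q → x ∉ q
x∈p─q⇒x∉q {p = inside ∷ p}  {inside ∷ q} {zero} () _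
x∈p─q⇒x∉q {p = outside ∷ p} {inside ∷ q} {zero} () _
x∈p─q⇒x∉q {p = _ ∷ p} {_ ∷ q} {suc x} x∈ x∈q = x∈p─q⇒x∉q {p = p} {q} (drop-there x∈) (drop-there x∈q)

-- Traces on a pair of sets and their total weight

-- q to the number of elements of X ∩ F ∩ G, or 0 unless X ⊆ F ∪ G.
weight : ℕ → Subset n → Subset n → Subset n → ℕ
weight q []            []            []            = 1
weight q (_ ∷ F)       (_ ∷ G)       (outside ∷ X) = weight q F G X
weight q (inside ∷ F)  (inside ∷ G)  (inside ∷ X)  = q · weight q F G X
weight q (inside ∷ F)  (outside ∷ G) (inside ∷ X)  = weight q F G X
weight q (outside ∷ F) (inside ∷ G)  (inside ∷ X)  = weight q F G X
weight q (outside ∷ F) (outside ∷ G) (inside ∷ X)  = 0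

-- A trace lies in `F ∪ G`, so the last clause of `weight` is never reached.
weight-∩∪ : ∀ q (F G H : Subset n) → let X = H ∩ (F ∪ G) in weight q F G X ≡ q ^ ∣ X ∩ (F ∩ G) ∣
weight-∩∪ q []            []            []            = refl
weight-∩∪ q (_ ∷ F)       (_ ∷ G)       (outside ∷ H) = weight-∩∪ q F G H
weight-∩∪ q (inside ∷ F)  (inside ∷ G)  (inside ∷ H)  = cong (q ·_) (weight-∩∪ q F G H)
weight-∩∪ q (inside ∷ F)  (outside ∷ G) (inside ∷ H)  = weight-∩∪ q F G H
weight-∩∪ q (outside ∷ F) (inside ∷ G)  (inside ∷ H)  = weight-∩∪ q F G H
weight-∩∪ q (outside ∷ F) (outside ∷ G) (inside ∷ H)  = weight-∩∪ q F G H

-- Coordinate by coordinate: an element of `H` in both `F` and `G` counts twice on either side, an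
-- element in exactly one of them once.
∣H∩F∣+∣H∩G∣ : (F G H : Subset n) → let X = H ∩ (F ∪ G) in
  ∣ H ∩ F ∣ + ∣ H ∩ G ∣ ≡ ∣ X ∣ + ∣ X ∩ (F ∩ G) ∣
∣H∩F∣+∣H∩G∣ []            []            []            = refl
∣H∩F∣+∣H∩G∣ (_ ∷ F)       (_ ∷ G)       (outside ∷ H) = ∣H∩F∣+∣H∩G∣ F G H
∣H∩F∣+∣H∩G∣ (inside ∷ F)  (inside ∷ G)  (inside ∷ H)  =
  cong suc (trans (ℕₚ.+-suc _ _) (trans (cong suc (∣H∩F∣+∣H∩G∣ F G H)) (sym (ℕₚ.+-suc _ _))))
∣H∩F∣+∣H∩G∣ (inside ∷ F)  (outside ∷ G) (inside ∷ H)  = cong suc (∣H∩F∣+∣H∩G∣ F G H)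
∣H∩F∣+∣H∩G∣ (outside ∷ F) (inside ∷ G)  (inside ∷ H)  = trans (ℕₚ.+-suc _ _) (cong suc (∣H∩F∣+∣H∩G∣ F G H))
∣H∩F∣+∣H∩G∣ (outside ∷ F) (outside ∷ G) (inside ∷ H)  = ∣H∩F∣+∣H∩G∣ F G H

sum-map-++ : {B : Set} (f : B → ℕ) (xs ys : List B) → sum (map f (xs ++ ys)) ≡ sum (map f xs) + sum (map f ys)
sum-map-++ f []       ys = refl
sum-map-++ f (x ∷ xs) ys = trans (cong (f x +_) (sum-map-++ f xs ys)) (sym (ℕₚ.+-assoc (f x) _ _))

sum-map-map : {B C : Set} (f : C → ℕ) (g : B → C) (c : ℕ) (h : B → ℕ) → (∀ b → f (g b) ≡ c · h b) →
  (xs : List B) → sum (map f (map g xs)) ≡ c · sum (map h xs)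
sum-map-map f g c h eq []       = sym (ℕₚ.*-zeroʳ c)
sum-map-map f g c h eq (x ∷ xs) =
  trans (cong₂ _+_ (eq x) (sum-map-map f g c h eq xs)) (sym (ℕₚ.*-distribˡ-+ c (h x) _))

-- The sum factors over the coordinates: each element of `F ∩ G` contributes `1 + q`, each element
-- of the symmetric difference 2, every other element 1.
sum-weight : ∀ q (F G : Subset n) →
  sum (map (weight q F G) (allSubsets n)) ≡ suc q ^ ∣ F ∩ G ∣ · 2 ^ ∣ (F ∪ G) ─ (F ∩ G) ∣
sum-weight q [] [] = refl
sum-weight {suc n} q (f ∷ F) (g ∷ G) = trans (sum-map-++ (weight q (f ∷ F) (g ∷ G)) (map (outside ∷_) (allSubsets n)) _)
  (trans (cong₂ _+_ (sum-map-map _ (outside ∷_) 1 (weight q F G) (λ _ → sym (ℕₚ.*-identityˡ _)) (allSubsets n))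
                    (with-head f g)) (step f g))
  where
  Σw = sum (map (weight q F G) (allSubsets n))
  coefficient : ∀ f g → ℕ
  coefficient inside  inside  = q
  coefficient inside  outside = 1
  coefficient outside inside  = 1
  coefficient outside outside = 0
  with-head : ∀ f g → sum (map (weight q (f ∷ F) (g ∷ G)) (map (inside ∷_) (allSubsets n))) ≡ coefficient f g · Σw
  with-head inside  inside  = sum-map-map _ (inside ∷_) q (weight q F G) (λ _ → refl) (allSubsets n)
  with-head inside  outside = sum-map-map _ (inside ∷_) 1 (weight q F G) (λ _ → sym (ℕₚ.*-identityˡ _)) (allSubsets n)
  with-head outside inside  = sum-map-map _ (inside ∷_) 1 (weight q F G) (λ _ → sym (ℕₚ.*-identityˡ _)) (allSubsets n)
  with-head outside outside = sum-map-map _ (inside ∷_) 0 (weight q F G) (λ _ → refl) (allSubsets n)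
  double : ∀ a b → 1 · (a · b) + 1 · (a · b) ≡ a · (2 · b)
  double = solve-∀
  step : ∀ f g → 1 · Σw + coefficient f g · Σw
    ≡ suc q ^ ∣ (f ∷ F) ∩ (g ∷ G) ∣ · 2 ^ ∣ ((f ∷ F) ∪ (g ∷ G)) ─ ((f ∷ F) ∩ (g ∷ G)) ∣
  step f g rewrite sum-weight q F G with f | g
  ... | inside  | inside  = lemma q (suc q ^ ∣ F ∩ G ∣) _
    where
    lemma : ∀ q a b → 1 · (a · b) + q · (a · b) ≡ (suc q · a) · b
    lemma = solve-∀
  ... | inside  | outside = double (suc q ^ ∣ F ∩ G ∣) _
  ... | outside | inside  = double (suc q ^ ∣ F ∩ G ∣) _
  ... | outside | outside = trans (ℕₚ.+-identityʳ _) (ℕₚ.*-identityˡ _)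

∣∪─∩∣ : (F G : Subset n) → ∣ (F ∪ G) ─ (F ∩ G) ∣ + 2 · ∣ F ∩ G ∣ ≡ ∣ F ∣ + ∣ G ∣
∣∪─∩∣ [] [] = refl
∣∪─∩∣ (inside ∷ F) (inside ∷ G) =
  trans (lemma _ _) (trans (cong (2 +_) (∣∪─∩∣ F G)) (cong suc (sym (ℕₚ.+-suc _ _))))
  where
  lemma : ∀ d i → d + 2 · suc i ≡ 2 + (d + 2 · i)
  lemma = solve-∀
∣∪─∩∣ (inside ∷ F) (outside ∷ G) = cong suc (∣∪─∩∣ F G)
∣∪─∩∣ (outside ∷ F) (inside ∷ G) = trans (cong suc (∣∪─∩∣ F G)) (sym (ℕₚ.+-suc _ _))
∣∪─∩∣ (outside ∷ F) (outside ∷ G) = ∣∪─∩∣ F G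

-- The estimate (1 + 1/q)ᵏ ≤ 3 for k ≤ q

*-^-distrib : ∀ a b k → (a · b) ^ k ≡ a ^ k · b ^ k
*-^-distrib a b zero    = refl
*-^-distrib a b (suc k) =
  trans (cong (a · b ·_) (*-^-distrib a b k)) (ℕₚ.[m*n]*[o*p]≡[m*o]*[n*p] a b (a ^ k) (b ^ k))

-- (1 + 1/q)ᵏ ≤ 1 + k/q + (k/q)² for k ≤ q, multiplied by qᵏ⁺².
suc-^-≤ : ∀ q k → k ≤ₙ q → suc q ^ k · (q · q) ≤ₙ q ^ k · (q · q + k · q + k · k)
suc-^-≤ q zero    _   = ℕₚ.≤-reflexive (lemma q)
  where
  lemma : ∀ q → 1 · (q · q) ≡ 1 · (q · q + 0 · q + 0 · 0)
  lemma = solve-∀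
suc-^-≤ q (suc k) k<q = begin
  (suc q · suc q ^ k) · (q · q)                              ≡⟨ ℕₚ.*-assoc (suc q) (suc q ^ k) (q · q) ⟩
  suc q · (suc q ^ k · (q · q))
    ≤⟨ ℕₚ.*-monoʳ-≤ (suc q) (suc-^-≤ q k (ℕₚ.<⇒≤ k<q)) ⟩
  suc q · (p · (q · q + k · q + k · k))                      ≡⟨ expand q p k ⟩
  p · (q · (q · q + q + k · q + k + k · k) + k · k)
    ≤⟨ ℕₚ.*-monoʳ-≤ p (ℕₚ.+-monoʳ-≤ (q · (q · q + q + k · q + k + k · k)) k²≤) ⟩
  p · (q · (q · q + q + k · q + k + k · k) + q · (1 + k))    ≡⟨ collect q p k ⟩
  (q · p) · (q · q + suc k · q + suc k · suc k)              ∎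
  where
  open ℕₚ.≤-Reasoning
  p = q ^ k
  -- The final `k · k` is the only term without a factor `q`; enlarging it to `q · (1 + k)` lets
  -- that factor move into the power.
  k²≤ : k · k ≤ₙ q · (1 + k)
  k²≤ = ℕₚ.*-mono-≤ (ℕₚ.<⇒≤ k<q) (ℕₚ.n≤1+n k)
  expand : ∀ q p k → suc q · (p · (q · q + k · q + k · k)) ≡ p · (q · (q · q + q + k · q + k + k · k) + k · k)
  expand = solve-∀
  collect : ∀ q p k → p · (q · (q · q + q + k · q + k + k · k) + q · (1 + k)) ≡ (q · p) · (q · q + suc k · q + suc k · suc k)
  collect = solve-∀

suc-^-≤-3 : ∀ q k → k ≤ₙ q → suc q ^ k ≤ₙ 3 · q ^ k
suc-^-≤-3 zero    zero    _   = s≤s z≤n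
suc-^-≤-3 (suc p) k k≤q = ℕₚ.*-cancelʳ-≤ _ _ (q · q) (begin
  suc q ^ k · (q · q)                      ≤⟨ suc-^-≤ q k k≤q ⟩
  q ^ k · (q · q + k · q + k · k)
    ≤⟨ ℕₚ.*-monoʳ-≤ (q ^ k) (ℕₚ.+-mono-≤ (ℕₚ.+-monoʳ-≤ (q · q) (ℕₚ.*-monoˡ-≤ q k≤q)) (ℕₚ.*-mono-≤ k≤q k≤q)) ⟩
  q ^ k · (q · q + q · q + q · q)          ≡⟨ lemma (q ^ k) (q · q) ⟩
  3 · q ^ k · (q · q)                      ∎)
  where
  open ℕₚ.≤-Reasoning
  q = suc p
  lemma : ∀ a b → a · (b + b + b) ≡ 3 · a · b
  lemma = solve-∀

-- Set systems as lists and what they cover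

∪⁅⁆-⊆ : {X F : Subset n} {y : Fin n} → X ⊆ F → y ∈ F → X ∪ ⁅ y ⁆ ⊆ F
∪⁅⁆-⊆ {X = X} {F} {y} X⊆F y∈F z∈ with x∈p∪q⁻ X ⁅ y ⁆ z∈
... | inj₁ z∈X = X⊆F z∈X
... | inj₂ z∈y = subst (_∈ F) (sym (x∈⁅y⁆⇒x≡y y z∈y)) y∈F

-- The case `F = G` is included, so every member has at least `t` elements.
TInt : ℕ → List (Subset n) → Set
TInt t L = ∀ {F G} → F ∈ₗ L → G ∈ₗ L → t ≤ₙ ∣ F ∩ G ∣

-- Phrased through common `t`-sets: replacing members by subsets preserves this form at once, and
-- its failure supplies the centre of a star.
Nontriv : ℕ → List (Subset n) → Set
Nontriv t L = ∀ T → ∣ T ∣ ≡ t → ¬ All (T ⊆_) L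

module _ {n : ℕ} (𝒜 : Family n) where

  Contains : Subset n → Pred (Subset n) 0ℓ
  Contains U A = 𝒜 A ≡ true × U ⊆ A

  contains? : ∀ U → Decidable (Contains U)
  contains? U A = (𝒜 A Bool.≟ true) ×-dec (U ⊆? A)

  -- Membership in `𝒜[𝒮]`, for `𝒮` listed by `L`.
  Covered : List (Subset n) → Pred (Subset n) 0ℓ
  Covered L A = 𝒜 A ≡ true × Any (_⊆ A) L

  covered? : ∀ L → Decidable (Covered L)
  covered? L A = (𝒜 A Bool.≟ true) ×-dec Any.any? (_⊆? A) L

  cov : List (Subset n) → ℕ
  cov L = count (covered? L)

  covered : ∀ {A F L} → 𝒜 A ≡ true → F ∈ₗ L → F ⊆ A → Covered L A
  covered A∈𝒜 F∈L F⊆A = A∈𝒜 , lose F∈L F⊆A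

  uncover : ∀ {A L} → Covered L A → ∃ λ F → F ∈ₗ L × F ⊆ A × 𝒜 A ≡ true
  uncover (A∈𝒜 , any) with find any
  ... | F , F∈L , F⊆A = F , F∈L , F⊆A , A∈𝒜

  cov-[] : cov [] ≡ 0
  cov-[] = count-∅ (covered? []) (λ { (_ , ()) })

  -- A superset of `F` is also a superset of `F′`; hence shrinking members loses nothing.
  cov-refine : ∀ {L L′} → (∀ {F} → F ∈ₗ L → ∃ λ F′ → F′ ∈ₗ L′ × F′ ⊆ F) → cov L ≤ₙ cov L′
  cov-refine {L} {L′} ref = count-mono (covered? L) (covered? L′) step
    where
    step : ∀ {A} → Covered L A → Covered L′ A
    step c with uncover c
    ... | F , F∈L , F⊆A , A∈𝒜 with ref F∈L
    ...   | F′ , F′∈L′ , F′⊆F = covered A∈𝒜 F′∈L′ (⊆-trans F′⊆F F⊆A)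

  cov-++ : ∀ L L′ → cov (L ++ L′) ≤ₙ cov L + cov L′
  cov-++ L L′ = count-∪ (covered? (L ++ L′)) (covered? L) (covered? L′) step
    where
    step : ∀ {A} → Covered (L ++ L′) A → Covered L A ⊎ Covered L′ A
    step (A∈𝒜 , any) with Anyₚ.++⁻ L any
    ... | inj₁ p = inj₁ (A∈𝒜 , p)
    ... | inj₂ p = inj₂ (A∈𝒜 , p)

  -- By `escape` each member of `L` contains some `y` of `G` outside `X`, so the sublists of members
  -- through such `y` together cover all that `L` covers.
  cov-branch : ∀ {m} (X G : Subset n) L → (∀ {F} → F ∈ₗ L → ∣ X ∩ G ∣ <ₙ ∣ F ∩ G ∣) →
    (∀ {y} → y ∉ X → cov (filter (y ∈?_) L) ≤ₙ m) → cov L ≤ₙ ∣ G ∣ · m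
  cov-branch {m} X G L esc bound = begin
    cov L
      ≤⟨ count-⋃-list (elements Y) (covered? L) (λ y → covered? (filter (y ∈?_) L)) split ⟩
    sum (map (λ y → cov (filter (y ∈?_) L)) (elements Y))
      ≤⟨ sum-map-≤ _ (elements Y) (λ y∈ → bound (x∈∁p⇒x∉p (proj₂ (x∈p∩q⁻ G (∁ X) (∈-elements⁻ y∈))))) ⟩
    length (elements Y) · m                                ≡⟨ cong (_· m) (length-elements Y) ⟩
    ∣ Y ∣ · m                                              ≤⟨ ℕₚ.*-monoˡ-≤ m (∣p∩q∣≤∣p∣ G (∁ X)) ⟩
    ∣ G ∣ · m                                              ∎
    where
    open ℕₚ.≤-Reasoning
    Y = G ∩ ∁ X
    split : ∀ {A} → Covered L A → ∃ λ y → y ∈ₗ elements Y × Covered (filter (y ∈?_) L) A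
    split c with uncover c
    ... | F , F∈L , F⊆A , A∈𝒜 with escape X F G (esc F∈L)
    ...   | y , y∈F , y∈G , y∉X =
      y , ∈-elements⁺ (x∈p∩q⁺ (y∈G , x∉p⇒x∈∁p y∉X)) , covered A∈𝒜 (∈-filter⁺ (y ∈?_) F∈L y∈F) F⊆A

  -- Bounds on covers from bounds `M k` on the degrees of sets of size `t + k`

  module _ (q t : ℕ) (q≥1 : 1 ≤ₙ q) (t≥1 : 1 ≤ₙ t) (M : ℕ → ℕ)
    (M-bound : ∀ k U → ∣ U ∣ ≡ t + k → count (contains? U) ≤ₙ M k) where

    cov-above : ∀ {k} U {L} → ∣ U ∣ ≡ t + k → (∀ {F} → F ∈ₗ L → U ⊆ F) → cov L ≤ₙ M k
    cov-above {k} U {L} ∣U∣ U⊆ = ℕₚ.≤-trans (count-mono (covered? L) (contains? U) step) (M-bound k U ∣U∣)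
      where
      step : ∀ {A} → Covered L A → Contains U A
      step c with uncover c
      ... | F , F∈L , F⊆A , A∈𝒜 = A∈𝒜 , ⊆-trans (U⊆ F∈L) F⊆A

    -- As `T` is not inside `G`, it meets `G` in fewer than `t` elements. Every member of `L`
    -- therefore contains a further element `y` of `G`, and with it the set `T ∪ ⁅ y ⁆` of size
    -- `t + 1`.
    cov-star : ∀ T G L → ∣ T ∣ ≡ t → ¬ T ⊆ G → ∣ G ∣ ≤ₙ q → (∀ {F} → F ∈ₗ L → t ≤ₙ ∣ F ∩ G ∣) →
      (∀ {F} → F ∈ₗ L → T ⊆ F) → cov L ≤ₙ q · M 1
    cov-star T G L ∣T∣ T⊈G G≤q int T⊆ = ℕₚ.≤-trans
      (cov-branch T G L (λ F∈L → ℕₚ.<-≤-trans T∩G<t (int F∈L)) above)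
      (ℕₚ.*-monoˡ-≤ (M 1) G≤q)
      where
      T∩G<t : ∣ T ∩ G ∣ <ₙ t
      T∩G<t = ℕₚ.≰⇒> λ t≤ → T⊈G (subst (_⊆ G)
        (⊆∧≥⇒≡ (p∩q⊆p T G) (subst (_≤ₙ ∣ T ∩ G ∣) (sym ∣T∣) t≤)) (p∩q⊆q T G))
      above : ∀ {y} → y ∉ T → cov (filter (y ∈?_) L) ≤ₙ M 1
      above {y} y∉T = cov-above (T ∪ ⁅ y ⁆) (trans (∣X∪⁅y⁆∣ T y∉T) (trans (cong suc ∣T∣) (ℕₚ.+-comm 1 t)))
        (λ F∈ → let F∈L , y∈F = ∈-filter⁻ (y ∈?_) {xs = L} F∈ in ∪⁅⁆-⊆ (T⊆ F∈L) y∈F)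

    -- A layer `W` of tight sets of size `t + s`

    module _ (s : ℕ) (t+s≤q : t + s ≤ₙ q) (W R : List (Subset n))
      (∣W∣ : ∀ {F} → F ∈ₗ W → ∣ F ∣ ≡ t + s) (sizes : ∀ {F} → F ∈ₗ W ++ R → ∣ F ∣ ≤ₙ t + s)
      (int : TInt t (W ++ R))
      (tight : ∀ {F x} → F ∈ₗ W → x ∈ F → ∃ λ G → G ∈ₗ W ++ R × ∣ (F - x) ∩ G ∣ <ₙ t) where

      -- Each of the `m` missing elements costs a factor `q`. For `x` in `F₀` outside `X`, tightness
      -- gives a `G` meeting `F₀ - x`, and hence its subset `X`, in fewer than `t` elements; all
      -- members of `L` then branch into this one `G`.
      cov-extend : ∀ m X L → L ⊆ₗ W → (∀ {F} → F ∈ₗ L → X ⊆ F) → ∣ X ∣ + m ≡ t + s → cov L ≤ₙ q ^ m · M s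
      cov-extend m       X []        L⊆W X⊆ ∣X∣ = subst (_≤ₙ q ^ m · M s) (sym cov-[]) z≤n
      cov-extend zero    X L         L⊆W X⊆ ∣X∣ =
        subst (cov L ≤ₙ_) (sym (ℕₚ.+-identityʳ (M s))) (cov-above X (trans (sym (ℕₚ.+-identityʳ _)) ∣X∣) X⊆)
      -- With `F₀` in both places, `escape` yields just an element of `F₀` outside `X`.
      cov-extend (suc m) X L@(F₀ ∷ _) L⊆W X⊆ ∣X∣ with escape X F₀ F₀ X<F₀
        where
        X<F₀ : ∣ X ∩ F₀ ∣ <ₙ ∣ F₀ ∩ F₀ ∣
        X<F₀ = begin-strict
          ∣ X ∩ F₀ ∣  ≤⟨ ∣p∩q∣≤∣p∣ X F₀ ⟩
          ∣ X ∣       <⟨ ℕₚ.m<m+n ∣ X ∣ (s≤s z≤n) ⟩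
          ∣ X ∣ + suc m ≡⟨ ∣X∣ ⟩
          t + s       ≡⟨ ∣W∣ (L⊆W (here refl)) ⟨
          ∣ F₀ ∣      ≡⟨ cong ∣_∣ (∩-idem F₀) ⟨
          ∣ F₀ ∩ F₀ ∣ ∎
          where open ℕₚ.≤-Reasoning
      ... | x , x∈F₀ , _ , x∉X with tight (L⊆W (here refl)) x∈F₀
      ...   | G , G∈ , F₀-x∩G<t = begin
        cov L
          ≤⟨ cov-branch X G L (λ F∈L → ℕₚ.<-≤-trans X∩G<t (int (∈-++⁺ˡ (L⊆W F∈L)) G∈)) next ⟩
        ∣ G ∣ · (q ^ m · M s)  ≤⟨ ℕₚ.*-monoˡ-≤ (q ^ m · M s) (ℕₚ.≤-trans (sizes G∈) t+s≤q) ⟩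
        q · (q ^ m · M s)      ≡⟨ ℕₚ.*-assoc q (q ^ m) (M s) ⟨
        q ^ suc m · M s        ∎
        where
        open ℕₚ.≤-Reasoning
        X∩G⊆ : X ∩ G ⊆ (F₀ - x) ∩ G
        X∩G⊆ z∈ with x∈p∩q⁻ X G z∈
        ... | z∈X , z∈G = x∈p∩q⁺ (x∈p∧x≢y⇒x∈p-y (X⊆ (here refl) z∈X) (λ { refl → x∉X z∈X }) , z∈G)
        X∩G<t : ∣ X ∩ G ∣ <ₙ t
        X∩G<t = ℕₚ.≤-<-trans (p⊆q⇒∣p∣≤∣q∣ X∩G⊆) F₀-x∩G<t
        next : ∀ {y} → y ∉ X → cov (filter (y ∈?_) L) ≤ₙ q ^ m · M s
        next {y} y∉X = cov-extend m (X ∪ ⁅ y ⁆) (filter (y ∈?_) L)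
          (λ F∈ → L⊆W (proj₁ (∈-filter⁻ (y ∈?_) {xs = L} F∈)))
          (λ F∈ → let F∈L , y∈F = ∈-filter⁻ (y ∈?_) {xs = L} F∈ in ∪⁅⁆-⊆ (X⊆ F∈L) y∈F)
          (trans (cong (_+ m) (∣X∪⁅y⁆∣ X y∉X)) (trans (sym (ℕₚ.+-suc _ m)) ∣X∣))

      -- Removing one `x` brings the intersection with `G` below `t` but lowers it by at most one.
      -- Such an `x` exists since `t ≥ 1` makes `F` nonempty.
      tight-pair : ∀ {F} → F ∈ₗ W → ∃ λ G → G ∈ₗ W ++ R × ∣ F ∩ G ∣ ≡ t
      tight-pair {F} F∈W with nonempty? F
      ... | no empty = contradiction (subst (1 ≤ₙ_)
          (trans (sym (∣W∣ F∈W)) (trans (cong ∣_∣ (Empty-unique empty)) (∣⊥∣≡0 n))) (ℕₚ.≤-trans t≥1 (ℕₚ.m≤m+n t s))) λ ()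
      ... | yes (x , x∈F) with tight F∈W x∈F
      ...   | G , G∈ , F-x∩G<t = G , G∈ , ℕₚ.≤-antisym ∣F∩G∣≤t (int (∈-++⁺ˡ F∈W) G∈)
        where
        open ℕₚ.≤-Reasoning
        F∩G⊆ : F ∩ G ⊆ ((F - x) ∩ G) ∪ ⁅ x ⁆
        F∩G⊆ {z} z∈ with x∈p∩q⁻ F G z∈ | z Finₚ.≟ x
        ... | _         | yes refl = x∈p∪q⁺ (inj₂ (x∈⁅x⁆ x))
        ... | z∈F , z∈G | no z≢x   = x∈p∪q⁺ (inj₁ (x∈p∩q⁺ (x∈p∧x≢y⇒x∈p-y z∈F z≢x , z∈G)))
        x∉ : x ∉ (F - x) ∩ G
        x∉ x∈ = x∈p─q⇒x∉q {p = F} {⁅ x ⁆} (proj₁ (x∈p∩q⁻ (F - x) G x∈)) (x∈⁅x⁆ x)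
        ∣F∩G∣≤t : ∣ F ∩ G ∣ ≤ₙ t
        ∣F∩G∣≤t = begin
          ∣ F ∩ G ∣                        ≤⟨ p⊆q⇒∣p∣≤∣q∣ F∩G⊆ ⟩
          ∣ ((F - x) ∩ G) ∪ ⁅ x ⁆ ∣        ≡⟨ ∣X∪⁅y⁆∣ _ x∉ ⟩
          suc ∣ (F - x) ∩ G ∣              ≤⟨ F-x∩G<t ⟩
          t                                ∎

      module _ {F G} (F∈W : F ∈ₗ W) (G∈ : G ∈ₗ W ++ R) (∣F∩G∣ : ∣ F ∩ G ∣ ≡ t) where

        trace? : ∀ X → Decidable (λ H → H ∩ (F ∪ G) ≡ X)
        trace? X H = (H ∩ (F ∪ G)) ≟ₛ X

        -- If some `H` has trace `X`, then `cov-extend` applies with `m = t + s ∸ ∣ X ∣`, and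
        -- `2t ≤ ∣ X ∣ + ∣ X ∩ (F ∩ G) ∣` turns the exponent `m + t` into `s + ∣ X ∩ (F ∩ G) ∣`. The
        -- factor `q ^ t` on the left avoids division.
        cov-trace : ∀ X → cov (filter (trace? X) W) · q ^ t ≤ₙ q ^ s · M s · weight q F G X
        cov-trace X with filter (trace? X) W in eq
        ... | [] = subst (λ c → c · q ^ t ≤ₙ q ^ s · M s · weight q F G X) (sym cov-[]) z≤n
        ... | H ∷ L = begin
          cov (H ∷ L) · q ^ t
            ≤⟨ ℕₚ.*-monoˡ-≤ (q ^ t) (cov-extend m X (H ∷ L) (proj₁ ∘ elim)
                (λ H∈ → subst (_⊆ _) (proj₂ (elim H∈)) (p∩q⊆p _ (F ∪ G))) (ℕₚ.m+[n∸m]≡n X≤)) ⟩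
          q ^ m · M s · q ^ t                        ≡⟨ swap (q ^ m) (M s) (q ^ t) ⟩
          q ^ m · q ^ t · M s                        ≡⟨ cong (_· M s) (ℕₚ.^-distribˡ-+-* q m t) ⟨
          q ^ (m + t) · M s
            ≤⟨ ℕₚ.*-monoˡ-≤ (M s) (ℕₚ.^-monoʳ-≤ q {{ℕ.>-nonZero q≥1}} exponent) ⟩
          q ^ (s + ∣ X ∩ (F ∩ G) ∣) · M s            ≡⟨ cong (_· M s) (ℕₚ.^-distribˡ-+-* q s _) ⟩
          q ^ s · q ^ ∣ X ∩ (F ∩ G) ∣ · M s          ≡⟨ swap (q ^ s) _ (M s) ⟩
          q ^ s · M s · q ^ ∣ X ∩ (F ∩ G) ∣          ≡⟨ cong (q ^ s · M s ·_) weight-X ⟨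
          q ^ s · M s · weight q F G X               ∎
          where
          open ℕₚ.≤-Reasoning
          swap : ∀ a b c → a · b · c ≡ a · c · b
          swap = solve-∀
          elim : ∀ {H′} → H′ ∈ₗ H ∷ L → H′ ∈ₗ W × H′ ∩ (F ∪ G) ≡ X
          elim H′∈ = ∈-filter⁻ (trace? X) {xs = W} (subst (_ ∈ₗ_) (sym eq) H′∈)
          H∈W = proj₁ (elim (here refl))
          X≡ = proj₂ (elim (here refl))
          weight-X : weight q F G X ≡ q ^ ∣ X ∩ (F ∩ G) ∣
          weight-X = subst (λ X → weight q F G X ≡ q ^ ∣ X ∩ (F ∩ G) ∣) X≡ (weight-∩∪ q F G H)
          X≤ : ∣ X ∣ ≤ₙ t + s
          X≤ = subst₂ _≤ₙ_ (cong ∣_∣ X≡) (∣W∣ H∈W) (∣p∩q∣≤∣p∣ H (F ∪ G))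
          m = t + s ∸ ∣ X ∣
          2t≤ : t + t ≤ₙ ∣ X ∣ + ∣ X ∩ (F ∩ G) ∣
          2t≤ = begin
            t + t
              ≤⟨ ℕₚ.+-mono-≤ (int (∈-++⁺ˡ H∈W) (∈-++⁺ˡ F∈W)) (int (∈-++⁺ˡ H∈W) G∈) ⟩
            ∣ H ∩ F ∣ + ∣ H ∩ G ∣          ≡⟨ ∣H∩F∣+∣H∩G∣ F G H ⟩
            _                              ≡⟨ cong (λ X → ∣ X ∣ + ∣ X ∩ (F ∩ G) ∣) X≡ ⟩
            ∣ X ∣ + ∣ X ∩ (F ∩ G) ∣        ∎
          exponent : m + t ≤ₙ s + ∣ X ∩ (F ∩ G) ∣
          exponent = ℕₚ.+-cancelˡ-≤ ∣ X ∣ _ _ (begin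
            ∣ X ∣ + (m + t)                      ≡⟨ ℕₚ.+-assoc ∣ X ∣ m t ⟨
            ∣ X ∣ + m + t                        ≡⟨ cong (_+ t) (ℕₚ.m+[n∸m]≡n X≤) ⟩
            t + s + t                            ≡⟨ rearrange₁ t s ⟩
            s + (t + t)                          ≤⟨ ℕₚ.+-monoʳ-≤ s 2t≤ ⟩
            s + (∣ X ∣ + ∣ X ∩ (F ∩ G) ∣)        ≡⟨ rearrange₂ s ∣ X ∣ _ ⟩
            ∣ X ∣ + (s + ∣ X ∩ (F ∩ G) ∣)        ∎)
            where
            rearrange₁ : ∀ t s → t + s + t ≡ s + (t + t)
            rearrange₁ = solve-∀
            rearrange₂ : ∀ s x i → s + (x + i) ≡ x + (s + i)
            rearrange₂ = solve-∀

        -- Summing over all traces gives the total weight `suc q ^ t` times a power of 2; the first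
        -- is at most `3 · q ^ t`, and `q ^ t` cancels.
        cov-by-traces : cov W ≤ₙ 3 · (4 · q) ^ s · M s
        cov-by-traces = ℕₚ.*-cancelʳ-≤ _ _ (q ^ t) {{ℕₚ.m^n≢0 q t {{ℕ.>-nonZero q≥1}}}} (begin
          cov W · q ^ t
            ≤⟨ ℕₚ.*-monoˡ-≤ (q ^ t) (count-⋃-list (allSubsets n) (covered? W)
                (λ X → covered? (filter (trace? X) W)) split) ⟩
          sum (map (λ X → cov (filter (trace? X) W)) (allSubsets n)) · q ^ t
            ≤⟨ sum-map-*-≤ _ (weight q F G) (q ^ t) (q ^ s · M s) cov-trace (allSubsets n) ⟩
          q ^ s · M s · sum (map (weight q F G) (allSubsets n))
            ≡⟨ cong (q ^ s · M s ·_) (sum-weight q F G) ⟩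
          q ^ s · M s · (suc q ^ ∣ F ∩ G ∣ · 2 ^ ∣ (F ∪ G) ─ (F ∩ G) ∣)
            ≤⟨ ℕₚ.*-monoʳ-≤ (q ^ s · M s) (ℕₚ.*-mono-≤ pow₁ pow₂) ⟩
          q ^ s · M s · (3 · q ^ t · 4 ^ s)
            ≡⟨ rearrange (q ^ s) (M s) (q ^ t) (4 ^ s) ⟩
          3 · (4 ^ s · q ^ s) · M s · q ^ t
            ≡⟨ cong (λ c → 3 · c · M s · q ^ t) (*-^-distrib 4 q s) ⟨
          3 · (4 · q) ^ s · M s · q ^ t                          ∎)
          where
          open ℕₚ.≤-Reasoning
          split : ∀ {A} → Covered W A → ∃ λ X → X ∈ₗ allSubsets n × Covered (filter (trace? X) W) A
          split c with uncover c
          ... | H , H∈W , H⊆A , A∈𝒜 =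
            H ∩ (F ∪ G) , ∈-allSubsets _ , covered A∈𝒜 (∈-filter⁺ (trace? _) H∈W refl) H⊆A
          pow₁ : suc q ^ ∣ F ∩ G ∣ ≤ₙ 3 · q ^ t
          pow₁ = subst (λ i → suc q ^ i ≤ₙ 3 · q ^ t) (sym ∣F∩G∣)
            (suc-^-≤-3 q t (ℕₚ.≤-trans (ℕₚ.m≤m+n t s) t+s≤q))
          -- Both sets have at most `t + s` elements and share exactly `t`.
          d≤2s : ∣ (F ∪ G) ─ (F ∩ G) ∣ ≤ₙ 2 · s
          d≤2s = ℕₚ.+-cancelʳ-≤ (2 · t) _ _ (begin
            ∣ (F ∪ G) ─ (F ∩ G) ∣ + 2 · t          ≡⟨ cong (λ i → ∣ (F ∪ G) ─ (F ∩ G) ∣ + 2 · i) ∣F∩G∣ ⟨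
            ∣ (F ∪ G) ─ (F ∩ G) ∣ + 2 · ∣ F ∩ G ∣  ≡⟨ ∣∪─∩∣ F G ⟩
            ∣ F ∣ + ∣ G ∣                          ≤⟨ ℕₚ.+-mono-≤ (sizes (∈-++⁺ˡ F∈W)) (sizes G∈) ⟩
            (t + s) + (t + s)                      ≡⟨ twice t s ⟩
            2 · s + 2 · t                          ∎)
            where
            twice : ∀ t s → (t + s) + (t + s) ≡ 2 · s + 2 · t
            twice = solve-∀
          pow₂ : 2 ^ ∣ (F ∪ G) ─ (F ∩ G) ∣ ≤ₙ 4 ^ s
          pow₂ = subst (2 ^ ∣ (F ∪ G) ─ (F ∩ G) ∣ ≤ₙ_) (sym (ℕₚ.^-*-assoc 2 2 s)) (ℕₚ.^-monoʳ-≤ 2 d≤2s)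
          rearrange : ∀ a b c d → a · b · (3 · c · d) ≡ 3 · (d · a) · b · c
          rearrange = solve-∀

      cov-tight : cov W ≤ₙ 3 · (4 · q) ^ s · M s
      cov-tight = by-head W refl
        where
        by-head : ∀ L → L ≡ W → cov W ≤ₙ 3 · (4 · q) ^ s · M s
        by-head []      eq = subst (_≤ₙ _) (sym (trans (cong cov (sym eq)) cov-[])) z≤n
        by-head (F ∷ _) eq = let F∈W = subst (F ∈ₗ_) eq (here refl) ; _ , G∈ , ∣F∩G∣ = tight-pair F∈W
                             in cov-by-traces F∈W G∈ ∣F∩G∣

    -- Peeling off the layers from the largest size downwards

    -- One term for each layer of size `t + 1` to `t + s`; the star contributes `q · M 1` once,
    -- since it ends the descent.
    bound : ℕ → ℕ
    bound zero    = q · M 1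
    bound (suc s) = 3 · (4 · q) ^ suc s · M (suc s) + bound s

    qM₁≤bound : ∀ s → q · M 1 ≤ₙ bound s
    qM₁≤bound zero    = ℕₚ.≤-refl
    qM₁≤bound (suc s) = ℕₚ.≤-trans (qM₁≤bound s) (ℕₚ.m≤n+m (bound s) _)

    Shrinkable : List (Subset n) → Subset n → Fin n → Set
    Shrinkable L F x = x ∈ F × All (λ G → t ≤ₙ ∣ (F - x) ∩ G ∣) L

    shrinkable? : ∀ L F x → Dec (Shrinkable L F x)
    shrinkable? L F x = (x ∈? F) ×-dec All.all? (λ G → t ℕ.≤? ∣ (F - x) ∩ G ∣) L

    -- W is the layer of sets of size t+s+1: as long as possible its members are
    -- shrunk by one element and moved to R, and what remains of W is then tight.
    peel : ∀ s → t + suc s ≤ₙ q →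
      (∀ L → (∀ {F} → F ∈ₗ L → ∣ F ∣ ≤ₙ t + s) → TInt t L → Nontriv t L → cov L ≤ₙ bound s) →
      ∀ k W R → length W ≤ₙ k → (∀ {F} → F ∈ₗ W → ∣ F ∣ ≡ t + suc s) → (∀ {F} → F ∈ₗ R → ∣ F ∣ ≤ₙ t + s) →
      TInt t (W ++ R) → Nontriv t (W ++ R) → cov (W ++ R) ≤ₙ bound (suc s)
    peel s t+s<q IH k W R W≤k ∣W∣ ∣R∣ int nontriv
      with Any.any? (λ F → Finₚ.any? (shrinkable? (W ++ R) F)) W
    ... | no ¬shrink = ℕₚ.≤-trans (cov-++ W R) (ℕₚ.+-mono-≤ W-bound (R-bound (anySubset? (λ T → (∣ T ∣ ℕ.≟ t) ×-dec All.all? (T ⊆?_) R))))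
      where
      sizes : ∀ {F} → F ∈ₗ W ++ R → ∣ F ∣ ≤ₙ t + suc s
      sizes F∈ with ∈-++⁻ W F∈
      ... | inj₁ F∈W = ℕₚ.≤-reflexive (∣W∣ F∈W)
      ... | inj₂ F∈R = ℕₚ.≤-trans (∣R∣ F∈R) (ℕₚ.+-monoʳ-≤ t (ℕₚ.n≤1+n s))
      tight : ∀ {F x} → F ∈ₗ W → x ∈ F → ∃ λ G → G ∈ₗ W ++ R × ∣ (F - x) ∩ G ∣ <ₙ t
      tight {F} {x} F∈W x∈F with find (¬All⇒Any¬ (λ G → t ℕ.≤? ∣ (F - x) ∩ G ∣) (W ++ R)
                                       (λ all → ¬shrink (lose F∈W (x , x∈F , all))))
      ... | G , G∈ , ¬t≤ = G , G∈ , ℕₚ.≰⇒> ¬t≤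
      W-bound : cov W ≤ₙ 3 · (4 · q) ^ suc s · M (suc s)
      W-bound = cov-tight (suc s) t+s<q W R ∣W∣ sizes int tight
      intR : TInt t R
      intR F∈ G∈ = int (∈-++⁺ʳ W F∈) (∈-++⁺ʳ W G∈)
      -- Without a common `t`-set in `R` the induction continues. Otherwise non-triviality of the
      -- whole list provides a `G` that does not contain `T`, yet meets every member of `R` in at
      -- least `t` elements.
      R-bound : Dec (∃ λ T → ∣ T ∣ ≡ t × All (T ⊆_) R) → cov R ≤ₙ bound s
      R-bound (no ¬star) = IH R ∣R∣ intR (λ T ∣T∣ all → ¬star (T , ∣T∣ , all))
      R-bound (yes (T , ∣T∣ , all)) with find (¬All⇒Any¬ (T ⊆?_) (W ++ R) (nontriv T ∣T∣))
      ... | G , G∈ , T⊈G = ℕₚ.≤-trans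
        (cov-star T G R ∣T∣ T⊈G (ℕₚ.≤-trans (sizes G∈) t+s<q) (λ F∈ → int (∈-++⁺ʳ W F∈) G∈) (All.lookup all))
        (qM₁≤bound s)
    peel s t+s<q IH zero    (_ ∷ _) R () ∣W∣ ∣R∣ int nontriv | yes shrink
    peel s t+s<q IH zero    []      R _  ∣W∣ ∣R∣ int nontriv | yes ()
    -- Filtering drops every copy of `F` from `W`, so the bound `k` on its length decreases.
    peel s t+s<q IH (suc k) W       R W≤k ∣W∣ ∣R∣ int nontriv | yes shrink with find shrink
    ... | F , F∈W , x , x∈F , all = ℕₚ.≤-trans (cov-refine refine)
        (peel s t+s<q IH k W′ R′ (ℕₚ.≤-pred (ℕₚ.≤-trans (filter-notAll ≢F? W (lose F∈W (λ F≢F → F≢F refl))) W≤k))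
          (∣W∣ ∘ proj₁ ∘ ∈-filter⁻ ≢F? {xs = W}) ∣R′∣ int′ nontriv′)
      where
      ≢F? : Decidable (_≢ F)
      ≢F? G = ¬? (G ≟ₛ F)
      F′ = F - x
      W′ = filter ≢F? W
      R′ = F′ ∷ R
      F′⊆F : F′ ⊆ F
      F′⊆F = p─q⊆p F ⁅ x ⁆
      old : ∀ {G} → G ∈ₗ W′ ++ R′ → G ≡ F′ ⊎ G ∈ₗ W ++ R
      old G∈ with ∈-++⁻ W′ G∈
      ... | inj₁ G∈W′        = inj₂ (∈-++⁺ˡ (proj₁ (∈-filter⁻ ≢F? {xs = W} G∈W′)))
      ... | inj₂ (here refl) = inj₁ refl
      ... | inj₂ (there G∈R) = inj₂ (∈-++⁺ʳ W G∈R)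
      refine : ∀ {G} → G ∈ₗ W ++ R → ∃ λ G′ → G′ ∈ₗ W′ ++ R′ × G′ ⊆ G
      refine {G} G∈ with ∈-++⁻ W G∈ | G ≟ₛ F
      ... | _        | yes refl = F′ , ∈-++⁺ʳ W′ (here refl) , F′⊆F
      ... | inj₁ G∈W | no G≢F   = G , ∈-++⁺ˡ (∈-filter⁺ ≢F? G∈W G≢F) , ⊆-refl
      ... | inj₂ G∈R | no _     = G , ∈-++⁺ʳ W′ (there G∈R) , ⊆-refl
      ∣R′∣ : ∀ {G} → G ∈ₗ R′ → ∣ G ∣ ≤ₙ t + s
      ∣R′∣ (here refl) = ℕₚ.≤-pred (subst (suc ∣ F′ ∣ ≤ₙ_) (trans (∣W∣ F∈W) (ℕₚ.+-suc t s)) (x∈p⇒∣p-x∣<∣p∣ x∈F))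
      ∣R′∣ (there G∈R) = ∣R∣ G∈R
      -- Testing `F′` against `F` itself already shows that `F′` has at least `t` elements.
      t≤F′∩F′ : t ≤ₙ ∣ F′ ∩ F′ ∣
      t≤F′∩F′ = ℕₚ.≤-trans (All.lookup all (∈-++⁺ˡ F∈W))
        (ℕₚ.≤-trans (∣p∩q∣≤∣p∣ F′ F) (ℕₚ.≤-reflexive (cong ∣_∣ (sym (∩-idem F′)))))
      int′ : TInt t (W′ ++ R′)
      int′ {G} {H} G∈ H∈ with old G∈ | old H∈
      ... | inj₁ refl | inj₁ refl = t≤F′∩F′
      ... | inj₁ refl | inj₂ H∈′  = All.lookup all H∈′
      ... | inj₂ G∈′  | inj₁ refl = subst (t ≤ₙ_) (cong ∣_∣ (∩-comm F′ G)) (All.lookup all G∈′)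
      ... | inj₂ G∈′  | inj₂ H∈′  = int G∈′ H∈′
      -- A set `T` inside all the shrunken members would lie inside all the original ones.
      nontriv′ : Nontriv t (W′ ++ R′)
      nontriv′ T ∣T∣ all′ = nontriv T ∣T∣ (All.tabulate λ G∈ →
        let _ , G′∈ , G′⊆G = refine G∈ in ⊆-trans (All.lookup all′ G′∈) G′⊆G)

    -- For `s = 0` all members have exactly `t` elements and pairwise meet in `t`, so they coincide,
    -- against non-triviality. For larger `s` the sets of top size are separated and peeled.
    cov-bound : ∀ s → t + s ≤ₙ q → ∀ L → (∀ {F} → F ∈ₗ L → ∣ F ∣ ≤ₙ t + s) → TInt t L → Nontriv t L → cov L ≤ₙ bound s
    cov-bound zero    _ []        _   _   _ = subst (_≤ₙ q · M 1) (sym cov-[]) z≤n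
    cov-bound zero    _ L@(F ∷ _) ∣L∣ int nontriv = ⊥-elim (nontriv F ∣F∣ (All.tabulate λ {G} G∈ → subst (_⊆ G)
        (⊆∧≥⇒≡ (p∩q⊆p F G) (ℕₚ.≤-trans (ℕₚ.≤-reflexive ∣F∣) (int (here refl) G∈))) (p∩q⊆q F G)))
      where
      ∣F∣ : ∣ F ∣ ≡ t
      ∣F∣ = ℕₚ.≤-antisym (subst (∣ F ∣ ≤ₙ_) (ℕₚ.+-identityʳ t) (∣L∣ (here refl)))
        (ℕₚ.≤-trans (int (here refl) (here refl)) (∣p∩q∣≤∣p∣ F F))
    cov-bound (suc s) t+s<q L ∣L∣ int nontriv = ℕₚ.≤-trans (cov-refine (λ F∈ → _ , sort F∈ , ⊆-refl))
        (peel s t+s<q (cov-bound s (ℕₚ.≤-trans (ℕₚ.+-monoʳ-≤ t (ℕₚ.n≤1+n s)) t+s<q)) (length W) W R ℕₚ.≤-refl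
          (proj₂ ∘ ∈-filter⁻ top? {xs = L}) ∣R∣ (λ F∈ G∈ → int (unsort F∈) (unsort G∈))
          (λ T ∣T∣ all → nontriv T ∣T∣ (All.tabulate (All.lookup all ∘ sort))))
      where
      top? : Decidable (λ F → ∣ F ∣ ≡ t + suc s)
      top? F = ∣ F ∣ ℕ.≟ t + suc s
      W = filter top? L
      R = filter (¬? ∘ top?) L
      sort : ∀ {F} → F ∈ₗ L → F ∈ₗ W ++ R
      sort {F} F∈ with top? F
      ... | yes p = ∈-++⁺ˡ (∈-filter⁺ top? F∈ p)
      ... | no ¬p = ∈-++⁺ʳ W (∈-filter⁺ (¬? ∘ top?) F∈ ¬p)
      unsort : ∀ {F} → F ∈ₗ W ++ R → F ∈ₗ L
      unsort F∈ with ∈-++⁻ W F∈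
      ... | inj₁ p = proj₁ (∈-filter⁻ top? {xs = L} p)
      ... | inj₂ p = proj₁ (∈-filter⁻ (¬? ∘ top?) {xs = L} p)
      ∣R∣ : ∀ {F} → F ∈ₗ R → ∣ F ∣ ≤ₙ t + s
      ∣R∣ {F} F∈R with ∈-filter⁻ (¬? ∘ top?) {xs = L} F∈R
      ... | F∈L , ≢ = ℕₚ.≤-pred (subst (∣ F ∣ <ₙ_) (ℕₚ.+-suc t s) (ℕₚ.≤∧≢⇒< (∣L∣ F∈L) ≢))

    -- The geometric series of the layer bounds

    -- The geometric sum 5 · bound s ≤ 3B(1 - 6⁻ˢ) + 5qM₁, multiplied by 6ˢ and free of subtraction.
    bound-geometric : ∀ {B} s → (∀ k → k <ₙ s → (24 · q) ^ suc k · M (suc k) ≤ₙ B) →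
      6 ^ s · (5 · bound s) + 3 · B ≤ₙ 6 ^ s · (3 · B + 5 · (q · M 1))
    bound-geometric {B} zero    h = ℕₚ.≤-reflexive (lemma B (q · M 1))
      where
      lemma : ∀ B c → 1 · (5 · c) + 3 · B ≡ 1 · (3 · B + 5 · c)
      lemma = solve-∀
    bound-geometric {B} (suc s) h = begin
      6 ^ suc s · (5 · (3 · (4 · q) ^ suc s · m + b)) + 3 · B    ≡⟨ expand (6 ^ s) ((4 · q) ^ suc s) m b B ⟩
      15 · (6 ^ suc s · (4 · q) ^ suc s · m) + 3 · B + 6 · (6 ^ s · (5 · b))
        ≤⟨ ℕₚ.+-monoˡ-≤ (6 · (6 ^ s · (5 · b))) (ℕₚ.+-monoˡ-≤ (3 · B) (ℕₚ.*-monoʳ-≤ 15 term≤B)) ⟩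
      -- Here 15 + 3 = 6 · 3 restores the correction term `3 · B` for the induction hypothesis.
      15 · B + 3 · B + 6 · (6 ^ s · (5 · b))                     ≡⟨ collect B (6 ^ s · (5 · b)) ⟩
      6 · (6 ^ s · (5 · b) + 3 · B)
        ≤⟨ ℕₚ.*-monoʳ-≤ 6 (bound-geometric s (λ k k<s → h k (ℕₚ.m≤n⇒m≤1+n k<s))) ⟩
      6 · (6 ^ s · (3 · B + 5 · (q · M 1)))
        ≡⟨ ℕₚ.*-assoc 6 (6 ^ s) (3 · B + 5 · (q · M 1)) ⟨
      6 ^ suc s · (3 · B + 5 · (q · M 1))                        ∎
      where
      open ℕₚ.≤-Reasoning
      m = M (suc s)
      b = bound s
      -- The constant 24 splits as 6 · 4: the 4 belongs to the layer bound, the 6 to the decay of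
      -- the series.
      term≤B : 6 ^ suc s · (4 · q) ^ suc s · m ≤ₙ B
      term≤B = subst (λ c → c · m ≤ₙ B)
        (trans (cong (_^ suc s) (ℕₚ.*-assoc 6 4 q)) (*-^-distrib 6 (4 · q) (suc s))) (h s ℕₚ.≤-refl)
      expand : ∀ p y m b B → 6 · p · (5 · (3 · y · m + b)) + 3 · B ≡ 15 · (6 · p · y · m) + 3 · B + 6 · (p · (5 · b))
      expand = solve-∀
      collect : ∀ B x → 15 · B + 3 · B + 6 · x ≡ 6 · (x + 3 · B)
      collect = solve-∀

    -- After multiplication by 5 the layers give at most `3 · B`, and the star at most
    -- `24 · (q · M 1)`, which is at most `B`.
    bound-≤ : ∀ {B} s → (∀ k → k ≤ₙ s → (24 · q) ^ suc k · M (suc k) ≤ₙ B) → bound s ≤ₙ B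
    bound-≤ {B} s h = ℕₚ.*-cancelˡ-≤ 5 (begin
      5 · bound s
        ≤⟨ ℕₚ.*-cancelˡ-≤ (6 ^ s) {{ℕₚ.m^n≢0 6 s}} (ℕₚ.≤-trans (ℕₚ.m≤m+n _ (3 · B))
            (bound-geometric s (λ k k<s → h k (ℕₚ.<⇒≤ k<s)))) ⟩
      3 · B + 5 · (q · M 1)     ≤⟨ ℕₚ.+-monoʳ-≤ (3 · B) (ℕₚ.*-monoˡ-≤ (q · M 1) {5} {24} (ℕₚ.m≤m+n 5 19)) ⟩
      3 · B + 24 · (q · M 1)    ≡⟨ cong (3 · B +_) (lemma q (M 1)) ⟩
      3 · B + (24 · q) ^ 1 · M 1  ≤⟨ ℕₚ.+-mono-≤ (ℕₚ.*-monoˡ-≤ B (ℕₚ.n≤1+n 3)) (h 0 z≤n) ⟩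
      4 · B + B                 ≡⟨ ℕₚ.+-comm (4 · B) B ⟩
      5 · B                     ∎)
      where
      open ℕₚ.≤-Reasoning
      lemma : ∀ q m → 24 · (q · m) ≡ 24 · q · 1 · m
      lemma = solve-∀

    -- The descent starts at `s = q ∸ t`. If `t` exceeds `q`, no set has both at least `t` and at
    -- most `q` elements, so `L` is empty.
    cov-≤ : ∀ {B} L → (∀ {F} → F ∈ₗ L → ∣ F ∣ ≤ₙ q) → TInt t L → Nontriv t L →
      (∀ k → k ≤ₙ q ∸ t → (24 · q) ^ suc k · M (suc k) ≤ₙ B) → cov L ≤ₙ B
    cov-≤ {B} L size int nontriv h with t ℕ.≤? q
    ... | yes t≤q = ℕₚ.≤-trans
      (cov-bound (q ∸ t) (ℕₚ.≤-reflexive t+s≡q) L (λ {F} F∈ → subst (∣ F ∣ ≤ₙ_) (sym t+s≡q) (size F∈)) int nontriv)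
      (bound-≤ (q ∸ t) h)
      where
      t+s≡q : t + (q ∸ t) ≡ q
      t+s≡q = ℕₚ.m+[n∸m]≡n t≤q
    ... | no t≰q = ℕₚ.≤-trans (cov-refine empty) (subst (_≤ₙ B) (sym cov-[]) z≤n)
      where
      empty : ∀ {F} → F ∈ₗ L → ∃ λ F′ → F′ ∈ₗ [] × F′ ⊆ F
      empty {F} F∈ = contradiction (ℕₚ.≤-trans (int F∈ F∈) (ℕₚ.≤-trans (∣p∩q∣≤∣p∣ F F) (size F∈))) t≰q

-- Maxima and rational estimates

-- The maximum is one of the values, or 0 for an empty list, so any property `P` of these passes to
-- it; `P` will be an inequality between rationals.
find-max : {B : Set} (P : ℕ → Set) (f : B → ℕ) (xs : List B) → P 0 → (∀ {b} → b ∈ₗ xs → P (f b)) →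
  ∃ λ m → P m × (∀ {b} → b ∈ₗ xs → f b ≤ₙ m)
find-max P f []       P0 Pf = 0 , P0 , λ ()
find-max P f (x ∷ xs) P0 Pf with find-max P f xs P0 (Pf ∘ there)
... | m , Pm , f≤m = f x ℕ.⊔ m , P-⊔ (ℕₚ.⊔-sel (f x) m) , bounded
  where
  P-⊔ : f x ℕ.⊔ m ≡ f x ⊎ f x ℕ.⊔ m ≡ m → P (f x ℕ.⊔ m)
  P-⊔ (inj₁ eq) = subst P (sym eq) (Pf (here refl))
  P-⊔ (inj₂ eq) = subst P (sym eq) Pm
  bounded : ∀ {b} → b ∈ₗ x ∷ xs → f b ≤ₙ f x ℕ.⊔ m
  bounded (here refl) = ℕₚ.m≤m⊔n (f x) m
  bounded (there b∈)  = ℕₚ.≤-trans (f≤m b∈) (ℕₚ.m≤n⊔m (f x) m)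

ℕ→ℚ-nonNeg : ∀ a → NonNegative (ℕ→ℚ a)
ℕ→ℚ-nonNeg a = ℚₚ.normalize-nonNeg a 1

ℕ→ℚ-mono : ∀ {a b} → a ≤ₙ b → ℕ→ℚ a ≤ ℕ→ℚ b
ℕ→ℚ-mono {a} {b} a≤b = toℚᵘ-cancel-≤ (begin
  toℚᵘ (ℕ→ℚ a)  ≃⟨ toℚᵘ-fromℚᵘ (mkℚᵘ (ℤ.+ a) 0) ⟩
  mkℚᵘ (ℤ.+ a) 0                ≤⟨ *≤* (ℤₚ.*-monoʳ-≤-nonNeg (ℤ.+ 1) (ℤ.+≤+ a≤b)) ⟩
  mkℚᵘ (ℤ.+ b) 0                ≃⟨ toℚᵘ-fromℚᵘ (mkℚᵘ (ℤ.+ b) 0) ⟨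
  toℚᵘ (ℕ→ℚ b)  ∎)
  where open ℚᵘₚ.≤-Reasoning

ℕ→ℚ-* : ∀ a b → ℕ→ℚ (a · b) ≡ ℕ→ℚ a * ℕ→ℚ b
ℕ→ℚ-* a b = toℚᵘ-injective (begin-equality
  toℚᵘ (ℕ→ℚ (a · b))                             ≃⟨ toℚᵘ-fromℚᵘ (mkℚᵘ (ℤ.+ (a · b)) 0) ⟩
  mkℚᵘ (ℤ.+ (a · b)) 0                                           ≃⟨ *≡* (cong (ℤ._* ℤ.+ 1) (ℤₚ.pos-* a b)) ⟩
  mkℚᵘ (ℤ.+ a) 0 ℚᵘ.* mkℚᵘ (ℤ.+ b) 0
    ≃⟨ ℚᵘₚ.*-cong (toℚᵘ-fromℚᵘ (mkℚᵘ (ℤ.+ a) 0)) (toℚᵘ-fromℚᵘ (mkℚᵘ (ℤ.+ b) 0)) ⟨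
  toℚᵘ (ℕ→ℚ a) ℚᵘ.* toℚᵘ (ℕ→ℚ b)  ≃⟨ toℚᵘ-homo-* (ℕ→ℚ a) (ℕ→ℚ b) ⟨
  toℚᵘ (ℕ→ℚ a * ℕ→ℚ b)                           ∎)
  where open ℚᵘₚ.≤-Reasoning

ℕ→ℚ-^ : ∀ a k → ℕ→ℚ (a ^ k) ≡ ℕ→ℚ a ^ℚ k
ℕ→ℚ-^ a zero    = refl
ℕ→ℚ-^ a (suc k) = trans (ℕ→ℚ-* a (a ^ k)) (cong (ℕ→ℚ a *_) (ℕ→ℚ-^ a k))

0≤ℕ→ℚ : ∀ a → 0ℚ ≤ ℕ→ℚ a
0≤ℕ→ℚ a = nonNegative⁻¹ (ℕ→ℚ a) {{ℕ→ℚ-nonNeg a}}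

*-mono-≤-nonNeg : ∀ {a b c d} → 0ℚ ≤ b → 0ℚ ≤ c → a ≤ b → c ≤ d → a * c ≤ b * d
*-mono-≤-nonNeg {a} {b} {c} {d} 0≤b 0≤c a≤b c≤d = ℚₚ.≤-trans
  (ℚₚ.*-monoʳ-≤-nonNeg c {{nonNegative 0≤c}} a≤b) (ℚₚ.*-monoˡ-≤-nonNeg b {{nonNegative 0≤b}} c≤d)

0≤* : ∀ {a b} → 0ℚ ≤ a → 0ℚ ≤ b → 0ℚ ≤ a * b
0≤* {a} {b} 0≤a 0≤b =
  nonNegative⁻¹ (a * b) {{nonNeg*nonNeg⇒nonNeg a {{nonNegative 0≤a}} b {{nonNegative 0≤b}}}}

0≤1 : 0ℚ ≤ 1ℚ
0≤1 = nonNegative⁻¹ 1ℚ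

^ℚ-nonNeg : ∀ {a} k → 0ℚ ≤ a → 0ℚ ≤ a ^ℚ k
^ℚ-nonNeg zero    0≤a = 0≤1
^ℚ-nonNeg (suc k) 0≤a = 0≤* 0≤a (^ℚ-nonNeg k 0≤a)

^ℚ-mono : ∀ {a b} k → 0ℚ ≤ a → a ≤ b → a ^ℚ k ≤ b ^ℚ k
^ℚ-mono zero    0≤a a≤b = ℚₚ.≤-refl
^ℚ-mono (suc k) 0≤a a≤b =
  *-mono-≤-nonNeg (ℚₚ.≤-trans 0≤a a≤b) (^ℚ-nonNeg k 0≤a) a≤b (^ℚ-mono k 0≤a a≤b)

^ℚ-≤1 : ∀ {a} k → 0ℚ ≤ a → a ≤ 1ℚ → a ^ℚ k ≤ 1ℚ
^ℚ-≤1 zero    0≤a a≤1 = ℚₚ.≤-refl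
^ℚ-≤1 (suc k) 0≤a a≤1 = *-mono-≤-nonNeg 0≤1 (^ℚ-nonNeg k 0≤a) a≤1 (^ℚ-≤1 k 0≤a a≤1)

*-^ℚ-distrib : ∀ a b k → (a * b) ^ℚ k ≡ a ^ℚ k * b ^ℚ k
*-^ℚ-distrib a b zero    = refl
*-^ℚ-distrib a b (suc k) = begin
  a * b * (a * b) ^ℚ k          ≡⟨ cong (a * b *_) (*-^ℚ-distrib a b k) ⟩
  a * b * (a ^ℚ k * b ^ℚ k)     ≡⟨ ℚₚ.*-assoc a b _ ⟩
  a * (b * (a ^ℚ k * b ^ℚ k))   ≡⟨ cong (a *_) (ℚₚ.*-assoc b (a ^ℚ k) _) ⟨
  a * (b * a ^ℚ k * b ^ℚ k)     ≡⟨ cong (λ c → a * (c * b ^ℚ k)) (ℚₚ.*-comm b (a ^ℚ k)) ⟩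
  a * (a ^ℚ k * b * b ^ℚ k)     ≡⟨ cong (a *_) (ℚₚ.*-assoc (a ^ℚ k) b _) ⟩
  a * (a ^ℚ k * (b * b ^ℚ k))   ≡⟨ ℚₚ.*-assoc a (a ^ℚ k) _ ⟨
  a * a ^ℚ k * (b * b ^ℚ k)     ∎
  where open ≡-Reasoning

-- From `c ≤ ε r` the left side is at most `ε ^ (k + 1) N`; one factor `ε` is kept and the others
-- are bounded by 1.
scale : ∀ {ε r N} c k m → 0ℚ ≤ ε → ε ≤ 1ℚ → 0ℚ ≤ N → ℕ→ℚ c ≤ ε * r →
  r ^ℚ suc k * ℕ→ℚ m ≤ N → ℕ→ℚ (c ^ suc k · m) ≤ ε * N
scale {ε} {r} {N} c k m 0≤ε ε≤1 0≤N c≤εr rm≤N = begin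
  ℕ→ℚ (c ^ j · m)               ≡⟨ trans (ℕ→ℚ-* (c ^ j) m) (cong (_* ℕ→ℚ m) (ℕ→ℚ-^ c j)) ⟩
  ℕ→ℚ c ^ℚ j * ℕ→ℚ m            ≤⟨ ℚₚ.*-monoʳ-≤-nonNeg (ℕ→ℚ m) {{ℕ→ℚ-nonNeg m}} (^ℚ-mono j (0≤ℕ→ℚ c) c≤εr) ⟩
  (ε * r) ^ℚ j * ℕ→ℚ m
    ≡⟨ trans (cong (_* ℕ→ℚ m) (*-^ℚ-distrib ε r j)) (ℚₚ.*-assoc (ε ^ℚ j) (r ^ℚ j) (ℕ→ℚ m)) ⟩
  ε ^ℚ j * (r ^ℚ j * ℕ→ℚ m)     ≤⟨ ℚₚ.*-monoˡ-≤-nonNeg (ε ^ℚ j) {{nonNegative (^ℚ-nonNeg j 0≤ε)}} rm≤N ⟩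
  ε * ε ^ℚ k * N
    ≤⟨ ℚₚ.*-monoʳ-≤-nonNeg N {{nonNegative 0≤N}} (ℚₚ.*-monoˡ-≤-nonNeg ε {{nonNegative 0≤ε}} (^ℚ-≤1 k 0≤ε ε≤1)) ⟩
  ε * 1ℚ * N                    ≡⟨ cong (_* N) (ℚₚ.*-identityʳ ε) ⟩
  ε * N                         ∎
  where
  open ℚₚ.≤-Reasoning
  j = suc k

-- Boolean families and the sizes of links

⊆ᵇ⇒⊆ : {X Y : Subset n} → T (X ⊆ᵇ Y) → X ⊆ Y
⊆ᵇ⇒⊆ {X = X} {Y} = toWitness {a? = X ⊆? Y}

⊆⇒⊆ᵇ : {X Y : Subset n} → X ⊆ Y → T (X ⊆ᵇ Y)
⊆⇒⊆ᵇ {X = X} {Y} = fromWitness {a? = X ⊆? Y}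

≡true⇒T : ∀ {b} → b ≡ true → T b
≡true⇒T = Equivalence.from T-≡

T⇒≡true : ∀ {b} → T b → b ≡ true
T⇒≡true = Equivalence.to T-≡

∈-members⁻ : {𝒜 : Family n} {A : Subset n} → A ∈ₗ members 𝒜 → 𝒜 A ≡ true
∈-members⁻ {n} {𝒜} = proj₂ ∘ ∈-filter⁻ (λ A → 𝒜 A Bool.≟ true) {xs = allSubsets n}

∈-members⁺ : {𝒜 : Family n} {A : Subset n} → 𝒜 A ≡ true → A ∈ₗ members 𝒜
∈-members⁺ {𝒜 = 𝒜} = ∈-filter⁺ (λ A → 𝒜 A Bool.≟ true) (∈-allSubsets _)

module _ (𝒜 : Family n) (U : Subset n) where

  ⟨⟩⁺ : ∀ {A} → 𝒜 A ≡ true → U ⊆ A → (𝒜 ⟨ U ⟩) (A ─ U) ≡ true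
  ⟨⟩⁺ A∈𝒜 U⊆A = T⇒≡true (Anyₚ.any⁺ _ (lose (∈-members⁺ {𝒜 = 𝒜} A∈𝒜)
    (Equivalence.from T-∧ (⊆⇒⊆ᵇ U⊆A , fromWitness refl))))

  ⟨⟩⁻ : ∀ {B} → (𝒜 ⟨ U ⟩) B ≡ true → ∃ λ A → 𝒜 A ≡ true × U ⊆ A × A ─ U ≡ B
  ⟨⟩⁻ B∈ with find (Anyₚ.any⁻ _ (members 𝒜) (≡true⇒T B∈))
  ... | A , A∈ , p = let U⊆A , eq = Equivalence.to T-∧ p in
    A , ∈-members⁻ {𝒜 = 𝒜} A∈ , ⊆ᵇ⇒⊆ U⊆A , toWitness eq

  ─-∪ : ∀ {A} → U ⊆ A → (A ─ U) ∪ U ≡ A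
  ─-∪ {A} U⊆A = ⊆-antisym to from
    where
    to : (A ─ U) ∪ U ⊆ A
    to x∈ = [ p─q⊆p A U , U⊆A ]′ (x∈p∪q⁻ (A ─ U) U x∈)
    from : A ⊆ (A ─ U) ∪ U
    from {x} x∈A with x ∈? U
    ... | yes x∈U = x∈p∪q⁺ (inj₂ x∈U)
    ... | no x∉U  = x∈p∪q⁺ (inj₁ (x∈p∧x∉q⇒x∈p─q x∈A x∉U))

  -- Removing `U` is injective on supersets of `U`, since adding `U` undoes it.
  count-contains≤#⟨⟩ : count (contains? 𝒜 U) ≤ₙ # (𝒜 ⟨ U ⟩)
  count-contains≤#⟨⟩ = count-injection (contains? 𝒜 U) _ (_─ U) (λ (A∈𝒜 , U⊆A) → ⟨⟩⁺ A∈𝒜 U⊆A)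
    (λ (_ , U⊆A) (_ , U⊆B) eq → trans (sym (─-∪ U⊆A)) (trans (cong (_∪ U) eq) (─-∪ U⊆B)))

  #⟨⟩≤#[] : # (𝒜 ⟨ U ⟩) ≤ₙ # (𝒜 [ U ])
  #⟨⟩≤#[] = count-injection _ _ (_∪ U) image inj
    where
    image : ∀ {B} → (𝒜 ⟨ U ⟩) B ≡ true → (𝒜 [ U ]) (B ∪ U) ≡ true
    image B∈ with ⟨⟩⁻ B∈
    ... | A , A∈𝒜 , U⊆A , refl rewrite ─-∪ U⊆A =
      T⇒≡true (Equivalence.from T-∧ (≡true⇒T A∈𝒜 , ⊆⇒⊆ᵇ U⊆A))
    inj : ∀ {B C} → (𝒜 ⟨ U ⟩) B ≡ true → (𝒜 ⟨ U ⟩) C ≡ true → B ∪ U ≡ C ∪ U → B ≡ C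
    inj B∈ C∈ eq with ⟨⟩⁻ B∈ | ⟨⟩⁻ C∈
    ... | A , _ , U⊆A , refl | A′ , _ , U⊆A′ , refl =
      cong (_─ U) (trans (sym (─-∪ U⊆A)) (trans eq (─-∪ U⊆A′)))

⊆-⋂ : (X : Subset n) (L : List (Subset n)) → All (X ⊆_) L → X ⊆ foldr _∩_ ⊤ L
⊆-⋂ X []      []            _   = ∈⊤
⊆-⋂ X (F ∷ L) (X⊆F ∷ X⊆L) x∈X = x∈p∩q⁺ (X⊆F x∈X , ⊆-⋂ X L X⊆L x∈X)

-- Maximal degrees and the final estimate

module _ (𝒜 𝒮 : Family n) where

  -- `M k` is the largest degree among sets of size `t + k`, or 0 if there are none; hence the two
  -- assumptions on `P`.
  supersets-max : ∀ t (P : ℕ → ℕ → Set) → (∀ k → P k 0) →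
    (∀ k U → ∣ U ∣ ≡ t + k → P k (count (contains? 𝒜 U))) →
    ∃ λ (M : ℕ → ℕ) → (∀ k → P k (M k)) × (∀ k U → ∣ U ∣ ≡ t + k → count (contains? 𝒜 U) ≤ₙ M k)
  supersets-max t P P0 PU = (λ k → proj₁ (max k)) , (λ k → proj₁ (proj₂ (max k))) ,
    λ k U ∣U∣ → proj₂ (proj₂ (max k)) (∈-filter⁺ (size? k) (∈-allSubsets U) ∣U∣)
    where
    size? : ∀ k → Decidable (λ (U : Subset n) → ∣ U ∣ ≡ t + k)
    size? k U = ∣ U ∣ ℕ.≟ t + k
    max : ∀ k → ∃ λ m → P k m × (∀ {U} → U ∈ₗ filter (size? k) (allSubsets n) → count (contains? 𝒜 U) ≤ₙ m)
    max k = find-max (P k) (λ U → count (contains? 𝒜 U)) (filter (size? k) (allSubsets n)) (P0 k)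
      (λ {U} U∈ → PU k U (proj₂ (∈-filter⁻ (size? k) {xs = allSubsets n} U∈)))

  #[[]]≤cov : # (𝒜 [[ 𝒮 ]]) ≤ₙ cov 𝒜 (members 𝒮)
  #[[]]≤cov = count-mono _ (covered? 𝒜 (members 𝒮)) cover
    where
    cover : ∀ {A} → (𝒜 [[ 𝒮 ]]) A ≡ true → Covered 𝒜 (members 𝒮) A
    cover A∈ with find (Anyₚ.any⁻ _ (members 𝒮) (≡true⇒T A∈))
    ... | F , F∈ , p = let A∈𝒜 , F⊆A = Equivalence.to T-∧ p in
      covered 𝒜 (T⇒≡true A∈𝒜) F∈ (⊆ᵇ⇒⊆ F⊆A)

members-TInt : ∀ {t} (𝒮 : Family n) → TIntersecting t 𝒮 → TInt t (members 𝒮)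
members-TInt 𝒮 int F∈ G∈ = int _ _ (∈-members⁻ {𝒜 = 𝒮} F∈) (∈-members⁻ {𝒜 = 𝒮} G∈)

members-Nontriv : ∀ {t} (𝒮 : Family n) → NonTrivial t 𝒮 → Nontriv t (members 𝒮)
members-Nontriv 𝒮 nontriv T ∣T∣ all =
  ℕₚ.<⇒≱ nontriv (subst (_≤ₙ ∣ ⋂ 𝒮 ∣) ∣T∣ (p⊆q⇒∣p∣≤∣q∣ (⊆-⋂ T (members 𝒮) all)))

-- The natural number `B` stands in for `ε * N`, so that the combinatorial induction can stay within
-- `ℕ`.
scaled-max : ∀ {ε r N} c (M : ℕ → ℕ) s → 0ℚ ≤ ε → ε ≤ 1ℚ → 0ℚ ≤ N → ℕ→ℚ c ≤ ε * r →
  (∀ k → r ^ℚ k * ℕ→ℚ (M k) ≤ N) →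
  ∃ λ B → ℕ→ℚ B ≤ ε * N × (∀ k → k ≤ₙ s → c ^ suc k · M (suc k) ≤ₙ B)
scaled-max {ε} {r} {N} c M s 0≤ε ε≤1 0≤N c≤εr rᵏM≤N =
  let B , B≤εN , term≤B = find-max (λ m → ℕ→ℚ m ≤ ε * N) (λ k → c ^ suc k · M (suc k)) (upTo (suc s)) (0≤* 0≤ε 0≤N)
        (λ {k} _ → scale c k (M (suc k)) 0≤ε ε≤1 0≤N c≤εr (rᵏM≤N (suc k)))
  in B , B≤εN , λ k k≤s → term≤B (∈-upTo⁺ (s≤s k≤s))

theorem12 : (ε : ℚ) → 0ℚ < ε → ε ≤ 1ℚ →
    (n : ℕ) (r : ℚ) (q t : ℕ) → n ≥ 1 → 1ℚ ≤ r → q ≥ 1 → t ≥ 1 →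
    ℕ→ℚ (24 Data.Nat.* q) ≤ ε * r →
    (𝒜 𝒮 : Family n) →
    WeaklySpread r t 𝒜 →
    AtMostSize q 𝒮 → TIntersecting t 𝒮 → NonTrivial t 𝒮 →
    Σ (Subset n) λ T → (∣ T ∣ ≡ t) ×
    (ℕ→ℚ (# (𝒜 [[ 𝒮 ]])) ≤ ε * ℕ→ℚ (# (𝒜 [ T ])))
theorem12 ε 0<ε ε≤1 n r q t _ 1≤r q≥1 t≥1 24q≤εr 𝒜 𝒮 (T₀ , ∣T₀∣ , spread) size int nontriv =
  -- The set `T₀` from the spreadness serves as the witness, since all degrees are bounded in terms
  -- of the size `N` of its link.
  T₀ , ∣T₀∣ , conclude (supersets-max 𝒜 𝒮 t (λ k m → r ^ℚ k * ℕ→ℚ m ≤ N) zero-bounded degree-bounded)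
  where
  open ℚₚ.≤-Reasoning
  N = ℕ→ℚ (# (𝒜 ⟨ T₀ ⟩))
  0≤N : 0ℚ ≤ N
  0≤N = 0≤ℕ→ℚ (# (𝒜 ⟨ T₀ ⟩))
  0≤ε : 0ℚ ≤ ε
  0≤ε = ℚₚ.<⇒≤ 0<ε
  zero-bounded : ∀ k → r ^ℚ k * ℕ→ℚ 0 ≤ N
  zero-bounded k = subst (_≤ N) (sym (ℚₚ.*-zeroʳ (r ^ℚ k))) 0≤N
  degree-bounded : ∀ k U → ∣ U ∣ ≡ t + k → r ^ℚ k * ℕ→ℚ (count (contains? 𝒜 U)) ≤ N
  degree-bounded k U ∣U∣ = ℚₚ.≤-trans
    (ℚₚ.*-monoˡ-≤-nonNeg (r ^ℚ k) {{nonNegative (^ℚ-nonNeg k (ℚₚ.≤-trans 0≤1 1≤r))}}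
      (ℕ→ℚ-mono (count-contains≤#⟨⟩ 𝒜 U)))
    (spread k U ∣U∣)
  conclude : (∃ λ (M : ℕ → ℕ) → (∀ k → r ^ℚ k * ℕ→ℚ (M k) ≤ N) ×
      (∀ k U → ∣ U ∣ ≡ t + k → count (contains? 𝒜 U) ≤ₙ M k)) →
    ℕ→ℚ (# (𝒜 [[ 𝒮 ]])) ≤ ε * ℕ→ℚ (# (𝒜 [ T₀ ]))
  conclude (M , rᵏM≤N , M-bound) =
    let B , B≤εN , term≤B = scaled-max (24 · q) M (q ∸ t) 0≤ε ε≤1 0≤N 24q≤εr rᵏM≤N
        cov≤B = cov-≤ 𝒜 q t q≥1 t≥1 M M-bound (members 𝒮) (λ {F} F∈ → size F (∈-members⁻ {𝒜 = 𝒮} F∈))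
                  (members-TInt 𝒮 int) (members-Nontriv 𝒮 nontriv) term≤B
    in begin
      ℕ→ℚ (# (𝒜 [[ 𝒮 ]]))      ≤⟨ ℕ→ℚ-mono (ℕₚ.≤-trans (#[[]]≤cov 𝒜 𝒮) cov≤B) ⟩
      ℕ→ℚ B                    ≤⟨ B≤εN ⟩
      ε * N                    ≤⟨ ℚₚ.*-monoˡ-≤-nonNeg ε {{nonNegative 0≤ε}} (ℕ→ℚ-mono (#⟨⟩≤#[] 𝒜 T₀)) ⟩
      ε * ℕ→ℚ (# (𝒜 [ T₀ ]))   ∎
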